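{- Let $\mathbb{F}_q$ be the finite field with $q$ elements and characteristic $p$, let $k\ge 1$ be an integer, and let $b\in\mathbb{F}_q$. (i) Suppose $k+1\le q-1$, let $\mathcal{C}_q$ be the standard Reed-Solomon code of dimension $k$ over $\mathbb{F}_q$ (evaluation set $D=\mathbb{F}_q$), and let $u\in\mathbb{F}_q^q$ be the word represented by a polynomial $u(x)=x^{k+1}-bx^k+v(x)$ with $v\in\mathbb{F}_q[x]$, $\deg(v)\le k-1$. Then $d(u,\mathcal{C}_q)=q-k$ if one of the following holds: (a) $b=0$, $p=2$, $k=1$; (b) $b=0$, $p=2$, $k=q-3$; otherwise, $d(u,\mathcal{C}_q)=q-k-1$. (ii) Suppose $q>5$ and $k+1\le q-2$, let $\mathcal{C}$ be the Reed-Solomon code of dimension $k$ over $\mathbb{F}_q$ with evaluation set $D=\mathbb{F}_q^*$, and let $u\in\mathbb{F}_q^{q-1}$ be the word represented by a polynomial $u(x)=x^{k+1}-bx^k+v(x)$ with $v\in\mathbb{F}_q[x]$, $\deg(v)\le k-1$. Then $d(u,\mathcal{C})=q-k-1$ if one of the following holds: (a) $b=0$, $p=2$, $k=1$; (b) $b=0$, $p=2$, $k=q-4$; (c) $b=0$, $k=q-3$; otherwise, $d(u,\mathcal{C})=q-k-2$.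
   Context: For an evaluation set $D=\{x_1,\dots,x_n\}\subseteq\mathbb{F}_q$ of $n$ distinct elements and $1\le k<n$, the Reed-Solomon code of dimension $k$ with evaluation set $D$ is $\mathcal{C}=\{(f(x_1),\dots,f(x_n)) : f\in\mathbb{F}_q[x],\ \deg f\le k-1\}\subseteq\mathbb{F}_q^n$ (the zero polynomial is allowed). It is called standard if $D=\mathbb{F}_q$ and primitive if $D=\mathbb{F}_q^*$. A word $u=(u_1,\dots,u_n)\in\mathbb{F}_q^n$ is represented by the unique polynomial $u(x)\in\mathbb{F}_q[x]$ of degree at most $n-1$ with $u(x_i)=u_i$ for all $i$. The error distance $d(u,\mathcal{C})$ is the minimum Hamming distance from $u$ to a codeword of $\mathcal{C}$. -}

module Defs where

open import Algebra.Bundles using (CommutativeRing)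
open import Data.Fin using (Fin)
open import Data.Fin.Properties using (inj⇒≟)
open import Data.List using (List; []; _∷_; _++_; map; foldr; replicate)
open import Data.Nat as ℕ using (ℕ; zero; suc; _∸_; _≤_; _<_)
open import Data.Product using (Σ; ∃; _×_)
open import Data.Vec using (allFin; count)
open import Function.Bundles using (Bijection)
open import Function.Definitions using (Injective)
open import Level using (_⊔_) renaming (suc to lsuc)
open import Relation.Binary.Definitions using (Decidable)
open import Relation.Binary.PropositionalEquality using (_≡_; setoid)
open import Relation.Nullary using (¬_)
open import Relation.Nullary.Decidable using (¬?)
open import Relation.Unary using (Pred)
import Algebra.Definitions.RawMonoid as RawMonoidDefinitions

record FiniteField c ℓ (q : ℕ) : Set (lsuc (c ⊔ ℓ)) where
  field
    commutativeRing : CommutativeRing c ℓ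

  open CommutativeRing commutativeRing public hiding (setoid)

  field
    0≉1         : ¬ (0# ≈ 1#)
    inverse     : ∀ x → ¬ (x ≈ 0#) → ∃ λ y → x * y ≈ 1#
    enumeration : Bijection (CommutativeRing.setoid commutativeRing) (setoid (Fin q))

  _≟_ : Decidable _≈_
  _≟_ = inj⇒≟ (Bijection.injection enumeration)

module _ {c ℓ} {q : ℕ} (F : FiniteField c ℓ q) where
  open FiniteField F
  open RawMonoidDefinitions +-rawMonoid using () renaming (_×_ to _times_)

  HasCharacteristic : ℕ → Set ℓ
  HasCharacteristic p =
    0 < p × p times 1# ≈ 0# × (∀ m → 0 < m → m times 1# ≈ 0# → p ≤ m)

module Polynomials {c ℓ} {q : ℕ} (F : FiniteField c ℓ q) where
  open FiniteField F

  -- Coefficients in increasing degree; trailing zeros are allowed, so a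
  -- polynomial has many representing lists.
  Poly : Set c
  Poly = List Carrier

  coeff : Poly → ℕ → Carrier
  coeff []      _       = 0#
  coeff (a ∷ f) zero    = a
  coeff (a ∷ f) (suc i) = coeff f i

  -- The zero polynomial satisfies this for every d.
  DegreeAtMost : ℕ → Poly → Set ℓ
  DegreeAtMost d f = ∀ i → d < i → coeff f i ≈ 0#

  eval : Poly → Carrier → Carrier
  eval f x = foldr (λ a r → a + x * r) 0# f

  infix  9 X^_
  infixr 8 _·ₚ_
  infixl 6 _+ₚ_ _-ₚ_

  X^_ : ℕ → Poly
  X^ n = replicate n 0# ++ 1# ∷ []

  _·ₚ_ : Carrier → Poly → Poly
  a ·ₚ f = map (a *_) f

  _+ₚ_ : Poly → Poly → Poly
  []      +ₚ g       = g
  (a ∷ f) +ₚ []      = a ∷ f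
  (a ∷ f) +ₚ (b ∷ g) = (a + b) ∷ (f +ₚ g)

  _-ₚ_ : Poly → Poly → Poly
  f -ₚ g = f +ₚ map -_ g

module Codes {c ℓ} {q : ℕ} (F : FiniteField c ℓ q) where
  open FiniteField F
  open Polynomials F

  record EvaluationSet (n : ℕ) : Set (c ⊔ ℓ) where
    field
      point    : Fin n → Carrier
      distinct : Injective _≡_ _≈_ point

  open EvaluationSet public

  Standard : ∀ {n} → EvaluationSet n → Set (c ⊔ ℓ)
  Standard D = ∀ a → ∃ λ i → point D i ≈ a

  Primitive : ∀ {n} → EvaluationSet n → Set (c ⊔ ℓ)
  Primitive D = (∀ i → ¬ (point D i ≈ 0#))
              × (∀ a → ¬ (a ≈ 0#) → ∃ λ i → point D i ≈ a)

  Word : ℕ → Set c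
  Word n = Fin n → Carrier

  -- Meaningful for 1 ≤ k: truncated subtraction identifies k = 0 with k = 1.
  ReedSolomon : ∀ {n} → EvaluationSet n → ℕ → Pred (Word n) (c ⊔ ℓ)
  ReedSolomon D k w =
    Σ Poly λ f → DegreeAtMost (k ∸ 1) f × (∀ i → w i ≈ eval f (point D i))

  IsRepresentedBy : ∀ {n} → EvaluationSet n → Word n → Poly → Set ℓ
  IsRepresentedBy {n} D u f =
    DegreeAtMost (n ∸ 1) f × (∀ i → eval f (point D i) ≈ u i)

  hamming : ∀ {n} → Word n → Word n → ℕ
  hamming {n} u w = count (λ i → ¬? (u i ≟ w i)) (allFin n)

  -- d(u, C) = d, the minimum being attained.
  ErrorDistance : ∀ {n s} → Word n → Pred (Word n) s → ℕ → Set (c ⊔ s)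
  ErrorDistance u C d =
    (∃ λ w → C w × hamming u w ≡ d) × (∀ w → C w → d ≤ hamming u w)

{-# OPTIONS --safe #-}
module Submission where

-- A codeword f differs from the word of p = X^(k+1) - b X^k + v at all points but the roots of
-- the monic polynomial p - f, and f ranges over all choices of the coefficients below X^k.  Hence
-- the distance is n - k - 1 if some k + 1 points of D have sum b, and n - k otherwise.
--
-- For b ≠ 0 such points exist: exchanging one element of a (k+1)-subset changes its sum, so some
-- sum is nonzero, and it can be scaled to b.  For b = 0 the subset is a union of pairs {x , δ - x},
-- with δ = 0 in odd characteristic and δ = 1 in characteristic two, together with at most four
-- further elements that correct the size and the sum.  In the exceptional cases the subset or its
-- complement has at most two elements; since the elements of the field add up to 0, a sum of 0
-- would make two distinct elements x, y satisfy x + y = 0 in characteristic two, or make a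
-- nonzero element vanish.

open import Defs
open import Algebra.Bundles using (CommutativeRing)
open import Data.Fin using (Fin; zero; suc)
open import Data.List using (List; []; _∷_; map; foldr; length; tabulate; take; filter; allFin)
open import Data.List.Properties using (length-map; length-tabulate; length-take)
open import Data.List.Relation.Unary.All as All using (All; []; _∷_)
open import Data.List.Relation.Unary.AllPairs using ([]; _∷_)
open import Data.List.Relation.Unary.Any as Any using (here; there)
open import Data.Nat as ℕ using (ℕ; zero; suc; _≤_; _<_; _∸_; z≤n; s≤s)
import Data.Nat.Properties as ℕ
open import Data.Product using (∃; _×_; _,_; proj₁; proj₂)
open import Data.Sum using (_⊎_; inj₁; inj₂)
open import Data.Unit using (⊤)
open import Function using (_∘_; _$_; id; Bijection)
open import Level using (Level)
open import Relation.Binary.Bundles using (Setoid)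
open import Relation.Binary.PropositionalEquality as ≡ using (_≡_)
open import Relation.Nullary using (¬_; yes; no; contradiction)
open import Relation.Nullary.Decidable using (¬?)
open import Relation.Unary using (Pred; Decidable)
import Algebra.Definitions.RawMonoid as RawMonoidDefinitions
import Algebra.Properties.Ring as RingProperties
import Algebra.Solver.Ring.NaturalCoefficients.Default as SemiringSolver
import Data.List.Membership.Setoid as Membership
import Data.List.Membership.Setoid.Properties as Membershipₚ
import Data.List.Relation.Unary.Unique.Setoid as Uniqueness
import Data.List.Relation.Unary.Unique.Setoid.Properties as Uniqueₚ
import Data.Vec as Vec
import Relation.Binary.Reasoning.Setoid as SetoidReasoning

parity : ∀ m → ∃ λ j → m ≡ j ℕ.* 2 ⊎ m ≡ suc (j ℕ.* 2)
parity zero = 0 , inj₁ ≡.refl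
parity (suc m) with parity m
... | j , inj₁ m≡2j   = j , inj₂ (≡.cong suc m≡2j)
... | j , inj₂ m≡1+2j = suc j , inj₁ (≡.cong suc m≡1+2j)

module FieldLists {c ℓ : Level} {q : ℕ} (F : FiniteField c ℓ q) where
  open FiniteField F hiding (zero)
  open RingProperties ring
  open RawMonoidDefinitions +-rawMonoid using () renaming (_×_ to _times_)
  open SemiringSolver commutativeSemiring using (solve; con; _:=_; _:+_; _:*_)

  S : Setoid c ℓ
  S = CommutativeRing.setoid commutativeRing

  open Membership S using (_∈_; _∉_)
  open Uniqueness S using (Unique)
  open SetoidReasoning S

  sum : List Carrier → Carrier
  sum = foldr _+_ 0#

  -- Lists without repetition

  length-─ : ∀ {x xs} (x∈xs : x ∈ xs) → length xs ≡ suc (length (xs Any.─ x∈xs))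
  length-─ (here _)      = ≡.refl
  length-─ (there x∈xs)  = ≡.cong suc (length-─ x∈xs)

  sum-─ : ∀ {x xs} (x∈xs : x ∈ xs) → sum xs ≈ x + sum (xs Any.─ x∈xs)
  sum-─ (here x≈y) = +-congʳ (sym x≈y)
  sum-─ {x} {y ∷ xs} (there x∈xs) = begin
    y + sum xs                      ≈⟨ +-congˡ (sum-─ x∈xs) ⟩
    y + (x + sum (xs Any.─ x∈xs))   ≈⟨ solve 3 (λ x y s → y :+ (x :+ s) := x :+ (y :+ s)) refl x y _ ⟩
    x + (y + sum (xs Any.─ x∈xs))   ∎

  ∈-─ : ∀ {x y xs} (x∈xs : x ∈ xs) → ¬ (x ≈ y) → y ∈ xs → y ∈ (xs Any.─ x∈xs)
  ∈-─ (here x≈z)   x≉y (here y≈z)   = contradiction (trans x≈z (sym y≈z)) x≉y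
  ∈-─ (here _)     _   (there y∈xs) = y∈xs
  ∈-─ (there _)    _   (here y≈z)   = here y≈z
  ∈-─ (there x∈xs) x≉y (there y∈xs) = there (∈-─ x∈xs x≉y y∈xs)

  infix 4 _⊆_
  _⊆_ : List Carrier → List Carrier → Set _
  xs ⊆ ys = ∀ {x} → x ∈ xs → x ∈ ys

  ⊆-─ : ∀ {x xs ys} → Unique (x ∷ xs) → x ∷ xs ⊆ ys → (x∈ys : x ∈ ys) → xs ⊆ (ys Any.─ x∈ys)
  ⊆-─ (x≉xs ∷ _) xs⊆ys x∈ys y∈xs =
    ∈-─ x∈ys (λ x≈y → Membershipₚ.All[≉]⇒∉ S x≉xs (Membershipₚ.∈-resp-≈ S (sym x≈y) y∈xs))
      (xs⊆ys (there y∈xs))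

  -- Pigeonhole: the head of `xs` is deleted from `ys`, and the tail of `xs` survives the deletion
  -- because it avoids the head.
  length-mono-⊆ : ∀ {xs ys} → Unique xs → xs ⊆ ys → length xs ≤ length ys
  length-mono-⊆ {[]} _ _ = z≤n
  length-mono-⊆ {x ∷ xs} xs!@(_ ∷ xs!′) xs⊆ys =
    ≡.subst (_ ≤_) (≡.sym (length-─ x∈ys))
      (s≤s (length-mono-⊆ xs!′ (⊆-─ xs! xs⊆ys x∈ys)))
    where x∈ys = xs⊆ys (here refl)

  -- When `ys` has no room to spare, the same deletions exhaust it, so `ys` is a permutation of
  -- `xs`.
  sum-cong-⊆ : ∀ {xs ys} → Unique xs → xs ⊆ ys → length ys ≤ length xs → sum xs ≈ sum ys
  sum-cong-⊆ {[]} {[]} _ _ _ = refl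
  sum-cong-⊆ {x ∷ xs} {ys} xs!@(_ ∷ xs!′) xs⊆ys ys≤xs = begin
    x + sum xs                  ≈⟨ +-congˡ (sum-cong-⊆ xs!′ (⊆-─ xs! xs⊆ys x∈ys) ys─≤xs) ⟩
    x + sum (ys Any.─ x∈ys)     ≈⟨ sum-─ x∈ys ⟨
    sum ys                      ∎
    where
    x∈ys = xs⊆ys (here refl)
    ys─≤xs = ℕ.≤-pred (≡.subst (_≤ _) (length-─ x∈ys) ys≤xs)

  ∈-or-fresh : ∀ ys xs → (xs ⊆ ys) ⊎ (∃ λ x → x ∉ ys)
  ∈-or-fresh ys [] = inj₁ λ ()
  ∈-or-fresh ys (x ∷ xs) with Any.any? (x ≟_) ys | ∈-or-fresh ys xs
  ... | no x∉ys  | _           = inj₂ (x , x∉ys)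
  ... | yes _    | inj₂ fresh  = inj₂ fresh
  ... | yes x∈ys | inj₁ xs⊆ys  = inj₁ λ where
    (here y≈x)   → Membershipₚ.∈-resp-≈ S (sym y≈x) x∈ys
    (there y∈xs) → xs⊆ys y∈xs

  -- The list of all field elements, and elements outside a given list.

  open Bijection enumeration using (to; injective; strictlySurjective)

  element : Fin q → Carrier
  element i = proj₁ (strictlySurjective i)

  to∘element : ∀ i → to (element i) ≡ i
  to∘element i = proj₂ (strictlySurjective i)

  elements : List Carrier
  elements = tabulate element

  elements! : Unique elements
  elements! = Uniqueₚ.tabulate⁺ S λ {i} {j} fi≈fj →
    ≡.trans (≡.sym (to∘element i)) (≡.trans (Bijection.cong enumeration fi≈fj) (to∘element j))

  ∈-elements : ∀ x → x ∈ elements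
  ∈-elements x = Membershipₚ.∈-resp-≈ S (injective (to∘element (to x)))
    (Membershipₚ.∈-tabulate⁺ S (to x))

  -- The list may repeat elements, so values to be avoided can be listed without checking that they
  -- differ.
  fresh : ∀ xs → length xs < q → ∃ λ x → x ∉ xs
  fresh xs xs<q with ∈-or-fresh xs elements
  ... | inj₂ x∉xs = x∉xs
  ... | inj₁ all∈xs = contradiction (length-mono-⊆ elements! all∈xs)
    (ℕ.<⇒≱ (≡.subst (length xs <_) (≡.sym (length-tabulate element)) xs<q))

  length≤q : ∀ {xs} → Unique xs → length xs ≤ q
  length≤q {xs} xs! = ≡.subst (length xs ≤_) (length-tabulate element) (length-mono-⊆ xs! (λ {x} _ → ∈-elements x))

  infixr 5 _∷!_
  _∷!_ : ∀ {x xs} → x ∉ xs → Unique xs → Unique (x ∷ xs)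
  x∉xs ∷! xs! = Membershipₚ.∉⇒All[≉] S x∉xs ∷ xs!

  ∉-∷ : ∀ {x y ys} → ¬ (x ≈ y) → x ∉ ys → x ∉ y ∷ ys
  ∉-∷ x≉y x∉ys (here x≈y)   = x≉y x≈y
  ∉-∷ x≉y x∉ys (there x∈ys) = x∉ys x∈ys

  -- Scaling by nonzero elements, and the sum of the whole field.

  sum-map-* : ∀ a xs → sum (map (a *_) xs) ≈ a * sum xs
  sum-map-* a [] = sym (zeroʳ a)
  sum-map-* a (x ∷ xs) = trans (+-congˡ (sum-map-* a xs)) (sym (distribˡ a x (sum xs)))

  *-cancelˡ-≉0 : ∀ {a x y} → ¬ (a ≈ 0#) → a * x ≈ a * y → x ≈ y
  *-cancelˡ-≉0 {a} {x} {y} a≉0 ax≈ay with inverse a a≉0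
  ... | a⁻¹ , aa⁻¹≈1 = begin
    x               ≈⟨ undo x ⟨
    a⁻¹ * (a * x)   ≈⟨ *-congˡ ax≈ay ⟩
    a⁻¹ * (a * y)   ≈⟨ undo y ⟩
    y               ∎
    where
    undo : ∀ z → a⁻¹ * (a * z) ≈ z
    undo z = begin
      a⁻¹ * (a * z)   ≈⟨ solve 3 (λ a b z → b :* (a :* z) := (a :* b) :* z) refl a a⁻¹ z ⟩
      (a * a⁻¹) * z   ≈⟨ *-congʳ aa⁻¹≈1 ⟩
      1# * z          ≈⟨ *-identityˡ z ⟩
      z               ∎

  x*y≈0⇒y≈0 : ∀ {x y} → ¬ (x ≈ 0#) → x * y ≈ 0# → y ≈ 0#
  x*y≈0⇒y≈0 {x} x≉0 xy≈0 = *-cancelˡ-≉0 x≉0 (trans xy≈0 (sym (zeroʳ x)))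

  unique-map-* : ∀ {a xs} → ¬ (a ≈ 0#) → Unique xs → Unique (map (a *_) xs)
  unique-map-* a≉0 = Uniqueₚ.map⁺ S S (*-cancelˡ-≉0 a≉0)

  -- The total is invariant under multiplication by some a ∉ {0, 1}.
  sum-all≈0 : 2 < q → ∀ {xs} → Unique xs → length xs ≡ q → sum xs ≈ 0#
  sum-all≈0 2<q {xs} xs! |xs|≡q with fresh (0# ∷ 1# ∷ []) 2<q
  ... | a , a∉ = x*y≈0⇒y≈0 a-1≉0 $ begin
    (a - 1#) * sum xs            ≈⟨ [y-z]x≈yx-zx (sum xs) a 1# ⟩
    a * sum xs - 1# * sum xs     ≈⟨ +-congˡ (-‿cong (*-identityˡ (sum xs))) ⟩
    a * sum xs - sum xs          ≈⟨ x≈y⇒x∙y⁻¹≈ε invariant ⟩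
    0#                           ∎
    where
    a-1≉0 : ¬ (a - 1# ≈ 0#)
    a-1≉0 a-1≈0 = a∉ (there (here (x∙y⁻¹≈ε⇒x≈y a 1# a-1≈0)))
    sum-full : ∀ {ys} → Unique ys → length ys ≡ q → sum ys ≈ sum elements
    sum-full ys! |ys|≡q = sum-cong-⊆ ys! (λ {x} _ → ∈-elements x)
      (ℕ.≤-reflexive (≡.trans (length-tabulate element) (≡.sym |ys|≡q)))
    invariant : a * sum xs ≈ sum xs
    invariant = begin
      a * sum xs           ≈⟨ sum-map-* a xs ⟨
      sum (map (a *_) xs)  ≈⟨ sum-full (unique-map-* (a∉ ∘ here) xs!) (≡.trans (length-map (a *_) xs) |xs|≡q) ⟩
      sum elements         ≈⟨ sum-full xs! |xs|≡q ⟨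
      sum xs               ∎

  -- Subset sums

  -- The predicate `P` lets the same constructions serve the whole field, its nonzero elements and
  -- the evaluation points.
  record SubsetSum {p} (P : Pred Carrier p) (m : ℕ) (s : Carrier) : Set (c Level.⊔ ℓ Level.⊔ p) where
    field
      subset : List Carrier
      unique : Unique subset
      within : ∀ {x} → x ∈ subset → P x
      size   : length subset ≡ m
      total  : sum subset ≈ s

  Any# : Pred Carrier _
  Any# _ = ⊤

  NonZero# : Pred Carrier _
  NonZero# x = ¬ (x ≈ 0#)

  -- The complement of such a set is {0}.
  cosize-1 : 2 < q → ∀ {xs} → Unique xs → suc (length xs) ≡ q → sum xs ≈ 0# → 0# ∉ xs
  cosize-1 2<q {xs} xs! |xs|+1≡q Σ≈0 0∈xs
    with fresh xs (ℕ.≤-reflexive |xs|+1≡q)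
  ... | x , x∉xs = x∉xs (Membershipₚ.∈-resp-≈ S (sym x≈0) 0∈xs)
    where
    x≈0 : x ≈ 0#
    x≈0 = begin
      x           ≈⟨ +-identityʳ x ⟨
      x + 0#      ≈⟨ +-congˡ Σ≈0 ⟨
      x + sum xs  ≈⟨ sum-all≈0 2<q (x∉xs ∷! xs!) |xs|+1≡q ⟩
      0#          ∎

  [1+1]x≈x+x : ∀ x → (1# + 1#) * x ≈ x + x
  [1+1]x≈x+x x = trans (distribʳ x 1# 1#) (+-cong (*-identityˡ x) (*-identityˡ x))

  x+y≈0⇒x≈y : 1# + 1# ≈ 0# → ∀ {x y} → x + y ≈ 0# → x ≈ y
  x+y≈0⇒x≈y 2≈0 {x} {y} x+y≈0 = +-cancelʳ y x y $ begin
    x + y            ≈⟨ x+y≈0 ⟩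
    0#               ≈⟨ zeroˡ y ⟨
    0# * y           ≈⟨ *-congʳ 2≈0 ⟨
    (1# + 1#) * y    ≈⟨ [1+1]x≈x+x y ⟩
    y + y            ∎

  ¬SubsetSum-2 : ∀ {p} {P : Pred Carrier p} → 1# + 1# ≈ 0# → ¬ SubsetSum P 2 0#
  ¬SubsetSum-2 2≈0 record { subset = x ∷ y ∷ [] ; unique = (x≉y ∷ _) ∷ _ ; total = Σ≈0 } =
    x≉y (x+y≈0⇒x≈y 2≈0 (trans (+-congˡ (sym (+-identityʳ y))) Σ≈0))

  -- The two missing elements add up to 0, because the whole field does; in characteristic two this
  -- makes them equal.
  cosize-2 : 1# + 1# ≈ 0# → 2 < q → ∀ {xs} → Unique xs → 2 ℕ.+ length xs ≡ q → ¬ (sum xs ≈ 0#)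
  cosize-2 2≈0 2<q {xs} xs! |xs|+2≡q Σ≈0
    with fresh xs (ℕ.<-trans (ℕ.n<1+n _) (ℕ.≤-reflexive |xs|+2≡q))
  ... | x , x∉xs with fresh (x ∷ xs) (ℕ.≤-reflexive |xs|+2≡q)
  ...   | y , y∉ = y∉ (here (x+y≈0⇒x≈y 2≈0 y+x≈0))
    where
    y+x≈0 : y + x ≈ 0#
    y+x≈0 = begin
      y + x             ≈⟨ +-congˡ (+-identityʳ x) ⟨
      y + (x + 0#)      ≈⟨ +-congˡ (+-congˡ Σ≈0) ⟨
      y + (x + sum xs)  ≈⟨ sum-all≈0 2<q (y∉ ∷! x∉xs ∷! xs!) |xs|+2≡q ⟩
      0#                ∎

  -- The list has one element to spare. Dropping `y` or dropping `x` gives different sums, so one of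
  -- them is nonzero, and scaling moves it to `b`.
  nonzero-SubsetSum : ∀ {p} {P : Pred Carrier p} →
    (∀ {a x} → ¬ (a ≈ 0#) → P x → P (a * x)) → (∀ {x y} → x ≈ y → P x → P y) →
    ∀ {m xs} → Unique xs → (∀ {x} → x ∈ xs → P x) → length xs ≡ 2 ℕ.+ m →
    ∀ {b} → ¬ (b ≈ 0#) → SubsetSum P (suc m) b
  nonzero-SubsetSum {P = P} P-scale P-resp {m} {x ∷ y ∷ xs}
    ((x≉y ∷ x≉xs) ∷ y≉xs ∷ xs!) xs⊆P |xs|≡ {b} b≉0 = choose
    where
    scale : ∀ {z} → All (λ w → ¬ (z ≈ w)) xs → (∀ {w} → w ∈ z ∷ xs → P w) →
            ¬ (z + sum xs ≈ 0#) → SubsetSum P (suc m) b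
    scale {z} z≉xs ⊆P s≉0 with inverse (z + sum xs) s≉0
    ... | s⁻¹ , ss⁻¹≈1 = record
      { subset = map (a *_) (z ∷ xs)
      ; unique = unique-map-* a≉0 (z≉xs ∷ xs!)
      ; within = λ w∈ → let v , v∈ , w≈av = Membershipₚ.∈-map⁻ S S w∈ in P-resp (sym w≈av) (P-scale a≉0 (⊆P v∈))
      ; size   = ≡.trans (length-map (a *_) (z ∷ xs)) (ℕ.suc-injective |xs|≡)
      ; total  = trans (sum-map-* a (z ∷ xs)) as≈b
      }
      where
      a = b * s⁻¹
      as≈b : a * (z + sum xs) ≈ b
      as≈b = begin
        b * s⁻¹ * (z + sum xs)    ≈⟨ solve 3 (λ b r s → b :* r :* s := b :* (s :* r)) refl b s⁻¹ (z + sum xs) ⟩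
        b * ((z + sum xs) * s⁻¹)  ≈⟨ *-congˡ ss⁻¹≈1 ⟩
        b * 1#                    ≈⟨ *-identityʳ b ⟩
        b                         ∎
      a≉0 : ¬ (a ≈ 0#)
      a≉0 a≈0 = b≉0 (trans (sym as≈b) (trans (*-congʳ a≈0) (zeroˡ _)))
    choose : SubsetSum P (suc m) b
    choose with (x + sum xs) ≟ 0#
    ... | no s≉0 = scale x≉xs (λ { (here e) → xs⊆P (here e) ; (there e) → xs⊆P (there (there e)) }) s≉0
    ... | yes s≈0 = scale y≉xs (xs⊆P ∘ there) λ s′≈0 →
      x≉y (+-cancelʳ (sum xs) x y (trans s≈0 (sym s′≈0)))

  -- Unions of pairs {x , δ - x}

  x≈y-z⇒x+z≈y : ∀ {x y z} → x ≈ y - z → x + z ≈ y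
  x≈y-z⇒x+z≈y {x} {y} {z} x≈y-z = begin
    x + z      ≈⟨ +-congʳ x≈y-z ⟩
    y - z + z  ≈⟨ //-rightDividesˡ z y ⟩
    y          ∎

  x+z≈y⇒x≈y-z : ∀ {x y z} → x + z ≈ y → x ≈ y - z
  x+z≈y⇒x≈y-z {x} {y} {z} x+z≈y = trans (sym (//-rightDividesʳ z x)) (+-congʳ x+z≈y)

  x+[δ-x]≈δ : ∀ δ x → x + (δ - x) ≈ δ
  x+[δ-x]≈δ δ x = trans (+-comm x (δ - x)) (//-rightDividesˡ x δ)

  -- `L` collects the used and the forbidden elements, and is closed under the involution sending x
  -- to δ - x. As it contains all fixed points, an element outside `L` has a different partner, also
  -- outside `L`.
  record PairClosed (δ : Carrier) (L : List Carrier) : Set (c Level.⊔ ℓ) where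
    field
      closed : ∀ {x} → x ∈ L → δ - x ∈ L
      fixed  : ∀ {x} → x + x ≈ δ → x ∈ L

  δ-[δ-x]≈x : ∀ δ x → x ≈ δ - (δ - x)
  δ-[δ-x]≈x δ x = x+z≈y⇒x≈y-z (x+[δ-x]≈δ δ x)

  PairClosed-∷ : ∀ {δ L} x → PairClosed δ L → PairClosed δ (x ∷ (δ - x) ∷ L)
  PairClosed-∷ {δ} x pc = record
    { closed = λ where
        (here y≈x)           → there (here (+-congˡ (-‿cong y≈x)))
        (there (here y≈δ-x)) → here (trans (+-congˡ (-‿cong y≈δ-x)) (sym (δ-[δ-x]≈x δ x)))
        (there (there y∈L))  → there (there (closed y∈L))
    ; fixed = λ x+x≈δ → there (there (fixed x+x≈δ))
    }
    where open PairClosed pc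

  ∉-pair : ∀ {δ L} → PairClosed δ L → ∀ {x} → x ∉ L → δ - x ∉ L
  ∉-pair {δ} pc {x} x∉L δ-x∈L =
    x∉L (Membershipₚ.∈-resp-≈ S (sym (δ-[δ-x]≈x δ x)) (PairClosed.closed pc δ-x∈L))

  -- Repetitions in the result are harmless: `L` matters only through membership and through its
  -- length as an upper bound.
  orbits : Carrier → List Carrier → List Carrier → List Carrier
  orbits δ xs L = foldr (λ x L → x ∷ (δ - x) ∷ L) L xs

  PairClosed-orbits : ∀ {δ L} xs → PairClosed δ L → PairClosed δ (orbits δ xs L)
  PairClosed-orbits []       pc = pc
  PairClosed-orbits (x ∷ xs) pc = PairClosed-∷ x (PairClosed-orbits xs pc)

  ⊆-orbits : ∀ {δ L} xs → xs ⊆ orbits δ xs L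
  ⊆-orbits (x ∷ xs) (here e)  = here e
  ⊆-orbits (x ∷ xs) (there e) = there (there (⊆-orbits xs e))

  -- The bound is 1 + q rather than q: if one element lies outside L, so does its
  -- partner, which is different from it.
  add-pairs : ∀ {δ L T} j → PairClosed δ L → T ⊆ L → Unique T → length L ℕ.+ j ℕ.* 2 ≤ suc q →
    SubsetSum (λ x → x ∈ T ⊎ x ∉ L) (length T ℕ.+ j ℕ.* 2) (sum T + j times δ)
  add-pairs {T = T} zero pc T⊆L T! _ = record
    { subset = T ; unique = T! ; within = inj₁
    ; size = ≡.sym (ℕ.+-identityʳ _) ; total = sym (+-identityʳ _) }
  add-pairs {δ} {L} {T} (suc j) pc T⊆L T! L+2j+2≤1+q
    with fresh L (ℕ.≤-pred (ℕ.≤-trans (ℕ.≤-reflexive (ℕ.+-comm 2 (length L)))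
        (ℕ.≤-trans (ℕ.+-monoʳ-≤ (length L) (s≤s (s≤s z≤n))) L+2j+2≤1+q)))
  ... | x , x∉L = record
    { subset = subset ; unique = unique
    ; within = back ∘ within
    ; size   = ≡.trans size (shift (length T))
    ; total  = begin
        sum subset                                 ≈⟨ total ⟩
        x + ((δ - x) + sum T) + j times δ
          ≈⟨ solve 4 (λ x y t d → (x :+ (y :+ t)) :+ d := t :+ ((x :+ y) :+ d))
               refl x (δ - x) (sum T) (j times δ) ⟩
        sum T + ((x + (δ - x)) + j times δ)        ≈⟨ +-congˡ (+-congʳ (x+[δ-x]≈δ δ x)) ⟩
        sum T + (δ + j times δ)                    ∎
    }
    where
    shift : ∀ l → 2 ℕ.+ l ℕ.+ j ℕ.* 2 ≡ l ℕ.+ suc j ℕ.* 2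
    shift l = ≡.trans (≡.cong (ℕ._+ j ℕ.* 2) (ℕ.+-comm 2 l)) (ℕ.+-assoc l 2 (j ℕ.* 2))
    x∉T = x∉L ∘ T⊆L
    δ-x∉T = ∉-pair pc x∉L ∘ T⊆L
    x≉δ-x : ¬ (x ≈ δ - x)
    x≉δ-x x≈δ-x = x∉L (PairClosed.fixed pc (x≈y-z⇒x+z≈y x≈δ-x))
    T′⊆L′ : x ∷ (δ - x) ∷ T ⊆ x ∷ (δ - x) ∷ L
    T′⊆L′ (here e)          = here e
    T′⊆L′ (there (here e))  = there (here e)
    T′⊆L′ (there (there e)) = there (there (T⊆L e))
    -- The pair joins both lists: `T` because it is chosen, `L` because later pairs must avoid it.
    open SubsetSum (add-pairs j (PairClosed-∷ x pc) T′⊆L′ (∉-∷ x≉δ-x x∉T ∷! δ-x∉T ∷! T!)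
      (≡.subst (_≤ suc q) (≡.sym (shift (length L))) L+2j+2≤1+q))
    back : ∀ {y} → y ∈ x ∷ (δ - x) ∷ T ⊎ y ∉ x ∷ (δ - x) ∷ L → y ∈ T ⊎ y ∉ L
    back (inj₁ (here y≈x))           = inj₂ (Membershipₚ.∉-resp-≈ S (sym y≈x) x∉L)
    back (inj₁ (there (here y≈δ-x))) = inj₂ (Membershipₚ.∉-resp-≈ S (sym y≈δ-x) (∉-pair pc x∉L))
    back (inj₁ (there (there y∈T)))  = inj₁ y∈T
    back (inj₂ y∉L′)                 = inj₂ (y∉L′ ∘ there ∘ there)

  convert : ∀ {p r} {P : Pred Carrier p} {R : Pred Carrier r} {m m′ s s′} →
    (∀ {x} → P x → R x) → m ≡ m′ → s ≈ s′ → SubsetSum P m s → SubsetSum R m′ s′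
  convert P⇒R m≡m′ s≈s′ X = record
    { subset = subset ; unique = unique ; within = P⇒R ∘ within
    ; size = ≡.trans size m≡m′ ; total = trans total s≈s′ }
    where open SubsetSum X

  -- Zero is kept out by putting it into `L` but not into `T`, so that no added pair can contain it.
  within-nonzero : ∀ {T L} → All (λ y → ¬ (0# ≈ y)) T → 0# ∈ L →
    ∀ {x} → x ∈ T ⊎ x ∉ L → NonZero# x
  within-nonzero 0≉T _ (inj₁ x∈T) x≈0 = Membershipₚ.All[≉]⇒∉ S 0≉T (Membershipₚ.∈-resp-≈ S x≈0 x∈T)
  within-nonzero _ 0∈L (inj₂ x∉L) x≈0 = x∉L (Membershipₚ.∈-resp-≈ S (sym x≈0) 0∈L)

  x≈-y⇒x+y≈0 : ∀ {x y} → x ≈ - y → x + y ≈ 0#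
  x≈-y⇒x+y≈0 {x} {y} x≈-y = trans (+-congʳ x≈-y) (-‿inverseˡ y)

  !₃ : ∀ {x y z} → ¬ (x ≈ y) → ¬ (x ≈ z) → ¬ (y ≈ z) → Unique (x ∷ y ∷ z ∷ [])
  !₃ x≉y x≉z y≉z = (x≉y ∷ x≉z ∷ []) ∷ (y≉z ∷ []) ∷ [] ∷ []

  -- Zero sums in odd characteristic.

  module Odd (2≉0 : ¬ (1# + 1# ≈ 0#)) where

    -- As 2 is nonzero, 0 is the only fixed point of negation.
    PairClosed-0 : PairClosed 0# (0# ∷ [])
    PairClosed-0 = record
      { closed = λ { (here x≈0) → here (trans (+-congˡ (trans (-‿cong x≈0) -0#≈0#)) (+-identityˡ 0#)) }
      ; fixed  = λ {x} x+x≈0 → here (x*y≈0⇒y≈0 2≉0 (trans ([1+1]x≈x+x x) x+x≈0))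
      }

    times-0 : ∀ j → j times 0# ≈ 0#
    times-0 zero    = refl
    times-0 (suc j) = trans (+-identityˡ _) (times-0 j)

    +times-0 : ∀ {s} j → s ≈ 0# → s + j times 0# ≈ 0#
    +times-0 j s≈0 = trans (+-cong s≈0 (times-0 j)) (+-identityˡ 0#)

    even-size : ∀ j → suc (j ℕ.* 2) ≤ q → SubsetSum NonZero# (j ℕ.* 2) 0#
    even-size j 1+2j≤q = convert (within-nonzero [] (here refl)) ≡.refl (+times-0 j refl)
      (add-pairs j PairClosed-0 (λ ()) [] (ℕ.m≤n⇒m≤1+n 1+2j≤q))

    -- Pairs {x, -x} give the even sizes, and 0 is added for the odd ones.
    zero-SubsetSum : ∀ m → suc m ≤ q → SubsetSum Any# m 0#
    zero-SubsetSum m m<q with parity m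
    ... | j , inj₁ ≡.refl = convert _ ≡.refl refl (even-size j m<q)
    ... | j , inj₂ ≡.refl = convert _ ≡.refl (+times-0 j (+-identityˡ 0#))
      (add-pairs j PairClosed-0 id ([] ∷ []) (ℕ.m≤n⇒m≤1+n (ℕ.<⇒≤ m<q)))

    zero-SubsetSum* : 5 < q → ∀ m → 2 ≤ m → 3 ℕ.+ m ≤ q → SubsetSum NonZero# m 0#
    zero-SubsetSum* 5<q m 2≤m 3+m≤q with parity m
    ... | j , inj₁ ≡.refl = even-size j (ℕ.≤-trans (ℕ.m≤n+m _ 2) 3+m≤q)
    ... | zero , inj₂ ≡.refl = contradiction 2≤m λ { (s≤s ()) }
    ... | suc j , inj₂ ≡.refl
      with inverse (1# + 1#) 2≉0
    ... | ½ , 2*½≈1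
      -- Avoiding 0 and 1 makes `a` nonzero and different from 1. The values -1, -2 and -1/2 are
      -- those at which -(1 + a) would equal 0, 1 and `a` respectively.
      with fresh (0# ∷ 1# ∷ - 1# ∷ - (1# + 1#) ∷ - ½ ∷ []) 5<q
    ... | a , a∉ = convert
        (within-nonzero (0≉1 ∷ a∉ ∘ here ∘ sym ∷ b≉0 ∘ sym ∷ [])
          (there (there (there (there (there (there (here refl))))))))
        ≡.refl (+times-0 j Σ≈0)
        (add-pairs j (PairClosed-orbits T PairClosed-0) (⊆-orbits T)
          (!₃ (a∉ ∘ there ∘ here ∘ sym) 1≉b a≉b) (s≤s 3+m≤q))
      where
      b = - (1# + a)
      T = 1# ∷ a ∷ b ∷ []
      b≉0 : ¬ (b ≈ 0#)
      b≉0 b≈0 = a∉ (there (there (here (+-inverseʳ-unique 1# a (-‿injective (trans b≈0 (sym -0#≈0#)))))))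
      1≉b : ¬ (1# ≈ b)
      1≉b 1≈b = a∉ (there (there (there (here
        (+-inverseʳ-unique (1# + 1#) a (trans (+-assoc 1# 1# a) (x≈-y⇒x+y≈0 1≈b)))))))
      a≉b : ¬ (a ≈ b)
      a≉b a≈b = a∉ (there (there (there (there (here (*-cancelˡ-≉0 2≉0 2a≈-2½))))))
        where
        1+2a≈0 : 1# + (a + a) ≈ 0#
        1+2a≈0 = trans (solve 2 (λ o a → o :+ (a :+ a) := a :+ (o :+ a)) refl 1# a) (x≈-y⇒x+y≈0 a≈b)
        2a≈-2½ : (1# + 1#) * a ≈ (1# + 1#) * - ½
        2a≈-2½ = begin
          (1# + 1#) * a      ≈⟨ [1+1]x≈x+x a ⟩
          a + a              ≈⟨ +-inverseʳ-unique 1# (a + a) 1+2a≈0 ⟩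
          - 1#               ≈⟨ -‿cong 2*½≈1 ⟨
          - ((1# + 1#) * ½)  ≈⟨ -‿distribʳ-* (1# + 1#) ½ ⟩
          (1# + 1#) * - ½    ∎
      Σ≈0 : sum T ≈ 0#
      Σ≈0 = begin
        1# + (a + (b + 0#))  ≈⟨ +-congˡ (+-congˡ (+-identityʳ b)) ⟩
        1# + (a + b)         ≈⟨ +-assoc 1# a b ⟨
        (1# + a) + b         ≈⟨ -‿inverseʳ (1# + a) ⟩
        0#                   ∎

  -- Zero sums in characteristic two.

  module Even (2≈0 : 1# + 1# ≈ 0#) where

    x+x≈0 : ∀ x → x + x ≈ 0#
    x+x≈0 x = trans (sym ([1+1]x≈x+x x)) (trans (*-congʳ 2≈0) (zeroˡ x))

    -- In characteristic two x + x is 0 and never 1, so sending x to 1 - x has no fixed points and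
    -- the empty list is already closed. A union of j pairs then sums to j modulo 2, which is why
    -- the sizes are treated modulo 4.
    PairClosed-1 : ∀ xs → PairClosed 1# (orbits 1# xs [])
    PairClosed-1 xs = PairClosed-orbits xs record
      { closed = λ ()
      ; fixed  = λ {x} x+x≈1 → contradiction (trans (sym (x+x≈0 x)) x+x≈1) 0≉1
      }

    even-times-1 : ∀ i → (i ℕ.* 2) times 1# ≈ 0#
    even-times-1 zero    = refl
    even-times-1 (suc i) = begin
      1# + (1# + (i ℕ.* 2) times 1#)  ≈⟨ +-assoc 1# 1# _ ⟨
      1# + 1# + (i ℕ.* 2) times 1#    ≈⟨ +-cong 2≈0 (even-times-1 i) ⟩
      0# + 0#                         ≈⟨ +-identityˡ 0# ⟩
      0#                              ∎

    +even-times-1 : ∀ {s} i → s ≈ 0# → s + (i ℕ.* 2) times 1# ≈ 0#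
    +even-times-1 i s≈0 = trans (+-cong s≈0 (even-times-1 i)) (+-identityˡ 0#)

    +odd-times-1 : ∀ {s} i → s ≈ 1# → s + suc (i ℕ.* 2) times 1# ≈ 0#
    +odd-times-1 {s} i s≈1 = begin
      s + (1# + (i ℕ.* 2) times 1#)  ≈⟨ +-assoc s 1# _ ⟨
      s + 1# + (i ℕ.* 2) times 1#    ≈⟨ +even-times-1 i (trans (+-congʳ s≈1) 2≈0) ⟩
      0#                             ∎

    1≈1-0 : 1# ≈ 1# - 0#
    1≈1-0 = x+z≈y⇒x≈y-z (+-identityʳ 1#)

    0≈1-1 : 0# ≈ 1# - 1#
    0≈1-1 = x+z≈y⇒x≈y-z (+-identityˡ 1#)

    -- The number of pairs is even, so their sum vanishes; the orbit {0, 1} is set aside to keep 0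
    -- out.
    size-4i : ∀ i → (i ℕ.* 2) ℕ.* 2 < q → SubsetSum NonZero# ((i ℕ.* 2) ℕ.* 2) 0#
    size-4i i m<q = convert (within-nonzero [] (here refl)) ≡.refl (+even-times-1 i refl)
      (add-pairs (i ℕ.* 2) (PairClosed-1 (0# ∷ [])) (λ ()) [] (s≤s m<q))

    size-4i+1 : ∀ i → suc ((i ℕ.* 2) ℕ.* 2) ≤ q → SubsetSum Any# (suc ((i ℕ.* 2) ℕ.* 2)) 0#
    size-4i+1 i m≤q = convert _ ≡.refl (+even-times-1 i (+-identityʳ 0#))
      (add-pairs (i ℕ.* 2) (PairClosed-1 (0# ∷ [])) (⊆-orbits (0# ∷ [])) ([] ∷ []) (s≤s m≤q))

    -- An odd number of pairs sums to 1, which the single element 1 cancels.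
    size-4i+3 : ∀ i → suc (suc (i ℕ.* 2) ℕ.* 2) ≤ q → SubsetSum NonZero# (suc (suc (i ℕ.* 2) ℕ.* 2)) 0#
    size-4i+3 i m≤q = convert (within-nonzero (0≉1 ∷ []) (here refl))
      ≡.refl (+odd-times-1 i (+-identityʳ 1#))
      (add-pairs (suc (i ℕ.* 2)) (PairClosed-1 (0# ∷ [])) 1∈L
        ([] ∷ []) (s≤s m≤q))
      where
      1∈L : 1# ∷ [] ⊆ orbits 1# (0# ∷ []) []
      1∈L (here x≈1) = there (here (trans x≈1 1≈1-0))

    -- Corrections by three or four elements of sum 1.

    module Large (4<q : 4 < q) where

      private
        a,a∉ = fresh (0# ∷ 1# ∷ []) (ℕ.<-trans (s≤s (s≤s (s≤s z≤n))) 4<q)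
        a = proj₁ a,a∉
        -- The excluded values form the span of 1 and `a` over the field of two elements, so 1, `a`,
        -- `b` are linearly independent over it.
        b,b∉ = fresh (0# ∷ 1# ∷ a ∷ (1# - a) ∷ []) 4<q
        b = proj₁ b,b∉

        a≉0 : ¬ (a ≈ 0#)
        a≉0 = proj₂ a,a∉ ∘ here
        a≉1 : ¬ (a ≈ 1#)
        a≉1 = proj₂ a,a∉ ∘ there ∘ here
        b≉0 : ¬ (b ≈ 0#)
        b≉0 = proj₂ b,b∉ ∘ here
        b≉1 : ¬ (b ≈ 1#)
        b≉1 = proj₂ b,b∉ ∘ there ∘ here
        b≉a : ¬ (b ≈ a)
        b≉a = proj₂ b,b∉ ∘ there ∘ there ∘ here
        a+b≉1 : ¬ (a + b ≈ 1#)
        a+b≉1 a+b≈1 = proj₂ b,b∉ (there (there (there (here (x+z≈y⇒x≈y-z (trans (+-comm b a) a+b≈1))))))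

        a+b≉0 : ¬ (a + b ≈ 0#)
        a+b≉0 a+b≈0 = b≉a (sym (x+y≈0⇒x≈y 2≈0 a+b≈0))

        -- `T₄` and `T₃` both sum to 1, to balance an odd number of pairs. `L` lists the eight
        -- elements of the span of 1, `a`, `b` over the field of two elements, and so contains both.
        T₄ T₃ L : List Carrier
        T₄ = 1# ∷ a ∷ b ∷ a + b ∷ []
        T₃ = a ∷ b ∷ 1# - (a + b) ∷ []
        L  = orbits 1# T₄ []

        T₄! : Unique T₄
        T₄! = (a≉1 ∘ sym ∷ b≉1 ∘ sym ∷ a+b≉1 ∘ sym ∷ [])
            ∷ !₃ (b≉a ∘ sym)
                 (λ a≈a+b → b≉0 (+-identityʳ-unique a b (sym a≈a+b)))
                 (λ b≈a+b → a≉0 (+-identityˡ-unique a b (sym b≈a+b)))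

        absorb : ∀ {x y} → x + (x + y) ≈ 1# → y ≈ 1#
        absorb {x} {y} x+x+y≈1 = begin
          y            ≈⟨ +-identityˡ y ⟨
          0# + y       ≈⟨ +-congʳ (x+x≈0 x) ⟨
          x + x + y    ≈⟨ +-assoc x x y ⟩
          x + (x + y)  ≈⟨ x+x+y≈1 ⟩
          1#           ∎

        T₃! : Unique T₃
        T₃! = !₃ (b≉a ∘ sym)
          (λ a≈ → b≉1 (absorb (x≈y-z⇒x+z≈y a≈)))
          (λ b≈ → a≉1 (absorb (trans (+-congˡ (+-comm b a)) (x≈y-z⇒x+z≈y b≈))))

        T₃⊆L : T₃ ⊆ L
        T₃⊆L (here e)                 = there (there (here e))
        T₃⊆L (there (here e))         = there (there (there (there (here e))))
        T₃⊆L (there (there (here e))) = there (there (there (there (there (there (there (here e)))))))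

        T₄-sum : sum T₄ ≈ 1#
        T₄-sum = begin
          1# + (a + (b + (a + b + 0#)))
            ≈⟨ solve 3 (λ o a b → o :+ (a :+ (b :+ (a :+ b :+ con 0))) := o :+ ((a :+ b) :+ (a :+ b)))
                 refl 1# a b ⟩
          1# + (a + b + (a + b))         ≈⟨ +-congˡ (x+x≈0 (a + b)) ⟩
          1# + 0#                        ≈⟨ +-identityʳ 1# ⟩
          1#                             ∎

        T₃-sum : sum T₃ ≈ 1#
        T₃-sum = begin
          a + (b + (1# - (a + b) + 0#))
            ≈⟨ solve 3 (λ a b d → a :+ (b :+ (d :+ con 0)) := (a :+ b) :+ d) refl a b (1# - (a + b)) ⟩
          (a + b) + (1# - (a + b))       ≈⟨ x+[δ-x]≈δ 1# (a + b) ⟩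
          1#                             ∎

        0∈L : 0# ∈ L
        0∈L = there (here 0≈1-1)

        0≉1-[a+b] : ¬ (0# ≈ 1# - (a + b))
        0≉1-[a+b] 0≈ = a+b≉1 (trans (sym (+-identityˡ (a + b))) (x≈y-z⇒x+z≈y 0≈))

      -- Pairs alone would be odd in number and leave the sum 1. Replacing two of them by `T₄` keeps
      -- the number odd, and the sums 1 and 1 cancel.
      size-4i+6 : ∀ i → 7 ℕ.+ (suc (i ℕ.* 2) ℕ.* 2) ≤ q →
        SubsetSum NonZero# (4 ℕ.+ (suc (i ℕ.* 2) ℕ.* 2)) 0#
      size-4i+6 i 3+m≤q = convert
        (within-nonzero (0≉1 ∷ a≉0 ∘ sym ∷ b≉0 ∘ sym ∷ a+b≉0 ∘ sym ∷ []) 0∈L)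
        ≡.refl (+odd-times-1 i T₄-sum)
        (add-pairs (suc (i ℕ.* 2)) (PairClosed-1 T₄) (⊆-orbits T₄) T₄! (s≤s 3+m≤q))

      size-4i+5 : ∀ i → 7 ℕ.+ (suc (i ℕ.* 2) ℕ.* 2) ≤ q →
        SubsetSum NonZero# (3 ℕ.+ (suc (i ℕ.* 2) ℕ.* 2)) 0#
      size-4i+5 i 4+m≤q = convert
        (within-nonzero (a≉0 ∘ sym ∷ b≉0 ∘ sym ∷ 0≉1-[a+b] ∷ []) 0∈L)
        ≡.refl (+odd-times-1 i T₃-sum)
        (add-pairs (suc (i ℕ.* 2)) (PairClosed-1 T₄) T₃⊆L T₃! (s≤s 4+m≤q))

    -- If q were 1 + 2j, pairing off everything but {0, 1} would overshoot q.
    1+2j≢q : ∀ j → ¬ (suc (j ℕ.* 2) ≡ q)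
    1+2j≢q j 1+2j≡q = ℕ.<⇒≱ (s≤s (ℕ.≤-reflexive (≡.sym 1+2j≡q))) (≡.subst (_≤ q) size (length≤q unique))
      where
      open SubsetSum (add-pairs j (PairClosed-1 (0# ∷ [])) id
        (((λ 0≈1-0 → 0≉1 (trans 0≈1-0 (sym 1≈1-0))) ∷ []) ∷ [] ∷ []) (s≤s (ℕ.≤-reflexive 1+2j≡q)))

    zero-SubsetSum : ∀ m → 1 ≤ m → suc m ≤ q → ¬ (m ≡ 2) → ¬ (2 ℕ.+ m ≡ q) → SubsetSum Any# m 0#
    zero-SubsetSum m 1≤m m<q m≢2 2+m≢q with parity m
    ... | j , inj₂ ≡.refl with parity j
    ...   | i , inj₁ ≡.refl = size-4i+1 i (ℕ.<⇒≤ m<q)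
    ...   | i , inj₂ ≡.refl = convert _ ≡.refl refl (size-4i+3 i (ℕ.<⇒≤ m<q))
    zero-SubsetSum m 1≤m m<q m≢2 2+m≢q | j , inj₁ ≡.refl with parity j
    ... | i , inj₁ ≡.refl     = convert _ ≡.refl refl (size-4i i m<q)
    ... | zero , inj₂ ≡.refl  = contradiction ≡.refl m≢2
    ... | suc i , inj₂ ≡.refl = convert _ ≡.refl refl (size-4i+6 i 3+m≤q)
      where
      -- Starting from `m < q`: 1 + m = q fails because `m` is even and `q` cannot be odd, and 2 + m
      -- = q is excluded by hypothesis.
      3+m≤q = ℕ.≤∧≢⇒< (ℕ.≤∧≢⇒< m<q (1+2j≢q j)) 2+m≢q
      open Large (ℕ.≤-trans (ℕ.m≤m+n 5 _) 3+m≤q)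

    -- Sizes 1 modulo 4 now go through `T₃`, and this case uses the full bound `4 + m ≤ q`.
    zero-SubsetSum* : ∀ m → 2 ≤ m → 4 ℕ.+ m ≤ q → ¬ (m ≡ 2) → SubsetSum NonZero# m 0#
    zero-SubsetSum* m 2≤m 4+m≤q m≢2 with parity m
    ... | j , inj₂ ≡.refl with parity j
    ...   | zero , inj₁ ≡.refl  = contradiction 2≤m λ { (s≤s ()) }
    ...   | suc i , inj₁ ≡.refl = size-4i+5 i 4+m≤q
      where open Large (ℕ.≤-trans (ℕ.m≤m+n 5 _) 4+m≤q)
    ...   | i , inj₂ ≡.refl = size-4i+3 i (ℕ.≤-trans (ℕ.m≤n+m _ 4) 4+m≤q)
    zero-SubsetSum* m 2≤m 4+m≤q m≢2 | j , inj₁ ≡.refl with parity j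
    ... | i , inj₁ ≡.refl     = size-4i i (ℕ.≤-trans (ℕ.m≤n+m _ 3) 4+m≤q)
    ... | zero , inj₂ ≡.refl  = contradiction ≡.refl m≢2
    ... | suc i , inj₂ ≡.refl = size-4i+6 i (ℕ.≤-trans (ℕ.m≤n+m _ 1) 4+m≤q)
      where open Large (ℕ.≤-trans (ℕ.m≤m+n 5 _) 4+m≤q)

-- Stated for an arbitrary tabulated `f`, since the induction passes to `f ∘ suc`; the application
-- takes `f` to be `id`.
count-¬+length-filter : ∀ {a p} {A : Set a} {P : Pred A p} (P? : Decidable P) {n} (f : Fin n → A) →
  Vec.count (¬? ∘ P?) (Vec.tabulate f) ℕ.+ length (filter P? (tabulate f)) ≡ n
count-¬+length-filter P? {zero}  f = ≡.refl
count-¬+length-filter P? {suc n} f with P? (f zero)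
... | yes _ = ≡.trans (ℕ.+-suc _ _) (≡.cong suc (count-¬+length-filter P? (f ∘ suc)))
... | no _  = ≡.cong suc (count-¬+length-filter P? (f ∘ suc))

module Interpolation {c ℓ : Level} {q : ℕ} (F : FiniteField c ℓ q) where
  open FiniteField F hiding (zero)
  open RingProperties ring
  open SemiringSolver commutativeSemiring using (solve; con; _:=_; _:+_; _:*_)
  open FieldLists F
  open Membership S using (_∈_; _∉_)
  open Uniqueness S using (Unique)
  open SetoidReasoning S
  open Polynomials F

  -- Polynomials

  coeff-+ₚ : ∀ f g i → coeff (f +ₚ g) i ≈ coeff f i + coeff g i
  coeff-+ₚ []      g       i       = sym (+-identityˡ _)
  coeff-+ₚ (a ∷ f) []      i       = sym (+-identityʳ _)
  coeff-+ₚ (a ∷ f) (b ∷ g) zero    = refl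
  coeff-+ₚ (a ∷ f) (b ∷ g) (suc i) = coeff-+ₚ f g i

  coeff-map : ∀ {h} → h 0# ≈ 0# → ∀ f i → coeff (map h f) i ≈ h (coeff f i)
  coeff-map h0≈0 []      i       = sym h0≈0
  coeff-map h0≈0 (a ∷ f) zero    = refl
  coeff-map h0≈0 (a ∷ f) (suc i) = coeff-map h0≈0 f i

  coeff-·ₚ : ∀ a f i → coeff (a ·ₚ f) i ≈ a * coeff f i
  coeff-·ₚ a = coeff-map (zeroʳ a)

  coeff--ₚ : ∀ f g i → coeff (f -ₚ g) i ≈ coeff f i - coeff g i
  coeff--ₚ f g i = trans (coeff-+ₚ f (map -_ g) i) (+-congˡ (coeff-map -0#≈0# g i))

  eval-+ₚ : ∀ f g x → eval (f +ₚ g) x ≈ eval f x + eval g x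
  eval-+ₚ []      g       x = sym (+-identityˡ _)
  eval-+ₚ (a ∷ f) []      x = sym (+-identityʳ _)
  eval-+ₚ (a ∷ f) (b ∷ g) x = begin
    a + b + x * eval (f +ₚ g) x              ≈⟨ +-congˡ (*-congˡ (eval-+ₚ f g x)) ⟩
    a + b + x * (eval f x + eval g x)
      ≈⟨ solve 5 (λ a b x u v → a :+ b :+ x :* (u :+ v) := (a :+ x :* u) :+ (b :+ x :* v))
           refl a b x _ _ ⟩
    (a + x * eval f x) + (b + x * eval g x)  ∎

  eval-·ₚ : ∀ a f x → eval (a ·ₚ f) x ≈ a * eval f x
  eval-·ₚ a []      x = sym (zeroʳ a)
  eval-·ₚ a (b ∷ f) x = trans (+-congˡ (*-congˡ (eval-·ₚ a f x)))
    (solve 4 (λ a b x u → a :* b :+ x :* (a :* u) := a :* (b :+ x :* u)) refl a b x _)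

  eval-neg : ∀ f x → eval (map -_ f) x ≈ - eval f x
  eval-neg []      x = sym -0#≈0#
  eval-neg (a ∷ f) x = begin
    - a + x * eval (map -_ f) x  ≈⟨ +-congˡ (*-congˡ (eval-neg f x)) ⟩
    - a + x * - eval f x         ≈⟨ +-congˡ (-‿distribʳ-* x _) ⟨
    - a + - (x * eval f x)       ≈⟨ -‿+-comm a _ ⟩
    - (a + x * eval f x)         ∎

  eval--ₚ : ∀ f g x → eval (f -ₚ g) x ≈ eval f x - eval g x
  eval--ₚ f g x = trans (eval-+ₚ f (map -_ g) x) (+-congˡ (eval-neg g x))

  eval-cong : ∀ f {x y} → x ≈ y → eval f x ≈ eval f y
  eval-cong []      x≈y = refl
  eval-cong (a ∷ f) x≈y = +-congˡ (*-cong x≈y (eval-cong f x≈y))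

  coeff-X^-≡ : ∀ n → coeff (X^ n) n ≈ 1#
  coeff-X^-≡ zero    = refl
  coeff-X^-≡ (suc n) = coeff-X^-≡ n

  coeff-X^-≢ : ∀ n i → ¬ (i ≡ n) → coeff (X^ n) i ≈ 0#
  coeff-X^-≢ zero    zero    i≢n = contradiction ≡.refl i≢n
  coeff-X^-≢ zero    (suc i) i≢n = refl
  coeff-X^-≢ (suc n) zero    i≢n = refl
  coeff-X^-≢ (suc n) (suc i) i≢n = coeff-X^-≢ n i (i≢n ∘ ≡.cong suc)

  -- With `d` = 0 this says that `f` is zero, which `DegreeAtMost` cannot express.
  -- `DegreeBelow (suc d)` unfolds to `DegreeAtMost d`.
  DegreeBelow : ℕ → Poly → Set ℓ
  DegreeBelow d f = ∀ i → d ≤ i → coeff f i ≈ 0#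

  eval-zero : ∀ f x → DegreeBelow 0 f → eval f x ≈ 0#
  eval-zero []      x f≈0 = refl
  eval-zero (a ∷ f) x f≈0 = begin
    a + x * eval f x  ≈⟨ +-cong (f≈0 0 z≤n) (*-congˡ (eval-zero f x (λ i _ → f≈0 (suc i) z≤n))) ⟩
    0# + x * 0#       ≈⟨ trans (+-identityˡ _) (zeroʳ x) ⟩
    0#                ∎

  -- The quotient of f - f(r) by X - r (Horner's scheme).
  quotient : Carrier → Poly → Poly
  quotient r []      = []
  quotient r (a ∷ f) = eval f r ∷ quotient r f

  -- f(x) = f(r) + (x - r) h(x), rearranged so that no subtraction occurs and the semiring
  -- solver applies.
  eval-quotient : ∀ r f x → eval f x + r * eval (quotient r f) x ≈ eval f r + x * eval (quotient r f) x
  eval-quotient r []      x = +-congˡ (trans (zeroʳ r) (sym (zeroʳ x)))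
  eval-quotient r (a ∷ f) x = begin
    a + x * f⟨x⟩ + r * (f⟨r⟩ + x * h)    ≈⟨ rearrange ⟩
    a + r * f⟨r⟩ + x * (f⟨x⟩ + r * h)    ≈⟨ +-congˡ (*-congˡ (eval-quotient r f x)) ⟩
    a + r * f⟨r⟩ + x * (f⟨r⟩ + x * h)    ∎
    where
    f⟨x⟩ = eval f x
    f⟨r⟩ = eval f r
    h = eval (quotient r f) x
    rearrange = solve 6
      (λ a x r u v h → a :+ x :* u :+ r :* (v :+ x :* h) := a :+ r :* v :+ x :* (u :+ r :* h))
      refl a x r f⟨x⟩ f⟨r⟩ h

  quotient-root : ∀ {r x} f → eval f r ≈ 0# → eval f x ≈ 0# → ¬ (r ≈ x) → eval (quotient r f) x ≈ 0#
  quotient-root {r} {x} f fr≈0 fx≈0 r≉x = x*y≈0⇒y≈0 (λ r-x≈0 → r≉x (x∙y⁻¹≈ε⇒x≈y r x r-x≈0)) $ begin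
    (r - x) * h       ≈⟨ [y-z]x≈yx-zx h r x ⟩
    r * h - x * h     ≈⟨ x≈y⇒x∙y⁻¹≈ε rh≈xh ⟩
    0#                ∎
    where
    h = eval (quotient r f) x
    rh≈xh : r * h ≈ x * h
    rh≈xh = begin
      r * h             ≈⟨ +-identityˡ _ ⟨
      0# + r * h        ≈⟨ +-congʳ fx≈0 ⟨
      eval f x + r * h  ≈⟨ eval-quotient r f x ⟩
      eval f r + x * h  ≈⟨ +-congʳ fr≈0 ⟩
      0# + x * h        ≈⟨ +-identityˡ _ ⟩
      x * h             ∎

  quotient-degree : ∀ d r f → DegreeBelow (suc d) f → DegreeBelow d (quotient r f)
  quotient-degree d       r []      _  i       _ = refl
  quotient-degree zero    r (a ∷ f) f< zero    _ = eval-zero f r (λ i _ → f< (suc i) (s≤s z≤n))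
  quotient-degree zero    r (a ∷ f) f< (suc i) _ =
    quotient-degree zero r f (λ j _ → f< (suc j) (s≤s z≤n)) i z≤n
  quotient-degree (suc d) r (a ∷ f) f< (suc i) (s≤s d≤i) =
    quotient-degree d r f (λ j d<j → f< (suc j) (s≤s d<j)) i d≤i

  -- The coefficients of the quotient are the values at `r` of the successive tails of `f`. Each
  -- tail's value is its first coefficient plus `r` times the value of the next tail, so if all
  -- values vanish, so do the coefficients.
  quotient-zero : ∀ r f → eval f r ≈ 0# → DegreeBelow 0 (quotient r f) → DegreeBelow 0 f
  quotient-zero r []      _    _   i       _ = refl
  quotient-zero r (a ∷ f) fr≈0 h≈0 (suc i) _ = quotient-zero r f (h≈0 0 z≤n) (λ j _ → h≈0 (suc j) z≤n) i z≤n
  quotient-zero r (a ∷ f) fr≈0 h≈0 zero    _ = begin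
    a                 ≈⟨ +-identityʳ a ⟨
    a + 0#            ≈⟨ +-congˡ (zeroʳ r) ⟨
    a + r * 0#        ≈⟨ +-congˡ (*-congˡ (h≈0 0 z≤n)) ⟨
    a + r * eval f r  ≈⟨ fr≈0 ⟩
    0#                ∎

  -- Dividing by X - r for one root r lowers the degree bound by one and keeps the other roots.
  roots⇒zero : ∀ {d rs} f → Unique rs → All (λ r → eval f r ≈ 0#) rs → d ≤ length rs →
    DegreeBelow d f → DegreeBelow 0 f
  roots⇒zero {zero} f _ _ _ f< = f<
  roots⇒zero {suc d} {r ∷ rs} f (r≉rs ∷ rs!) (fr≈0 ∷ frs≈0) (s≤s d≤|rs|) f< =
    quotient-zero r f fr≈0 (roots⇒zero (quotient r f) rs!
      (All.zipWith (λ (fx≈0 , r≉x) → quotient-root f fr≈0 fx≈0 r≉x) (frs≈0 , r≉rs))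
      d≤|rs| (quotient-degree d r f f<))

  -- Monic polynomials with prescribed roots.

  fromRoots : List Carrier → Poly
  fromRoots []       = 1# ∷ []
  fromRoots (r ∷ rs) = (0# ∷ fromRoots rs) -ₚ r ·ₚ fromRoots rs

  coeff-fromRoots-suc : ∀ r rs i →
    coeff (fromRoots (r ∷ rs)) (suc i) ≈ coeff (fromRoots rs) i - r * coeff (fromRoots rs) (suc i)
  coeff-fromRoots-suc r rs i = trans (coeff--ₚ (0# ∷ fromRoots rs) (r ·ₚ fromRoots rs) (suc i))
    (+-congˡ (-‿cong (coeff-·ₚ r (fromRoots rs) (suc i))))

  x-r0≈x : ∀ x r {y} → y ≈ 0# → x - r * y ≈ x
  x-r0≈x x r {y} y≈0 = begin
    x - r * y  ≈⟨ +-congˡ (-‿cong (trans (*-congˡ y≈0) (zeroʳ r))) ⟩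
    x - 0#     ≈⟨ +-congˡ -0#≈0# ⟩
    x + 0#     ≈⟨ +-identityʳ x ⟩
    x          ∎

  fromRoots-degree : ∀ rs → DegreeBelow (suc (length rs)) (fromRoots rs)
  fromRoots-degree []       (suc i) _         = refl
  fromRoots-degree (r ∷ rs) (suc i) (s≤s n≤i) = trans (coeff-fromRoots-suc r rs i)
    (trans (x-r0≈x _ r (fromRoots-degree rs (suc i) (ℕ.m≤n⇒m≤1+n n≤i))) (fromRoots-degree rs i n≤i))

  fromRoots-leading : ∀ rs → coeff (fromRoots rs) (length rs) ≈ 1#
  fromRoots-leading []       = refl
  fromRoots-leading (r ∷ rs) = trans (coeff-fromRoots-suc r rs (length rs))
    (trans (x-r0≈x _ r (fromRoots-degree rs _ ℕ.≤-refl)) (fromRoots-leading rs))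

  fromRoots-leading′ : ∀ {n} rs → length rs ≡ n → coeff (fromRoots rs) n ≈ 1#
  fromRoots-leading′ rs ≡.refl = fromRoots-leading rs

  -- One of Vieta's formulas: multiplication by X - r subtracts `r` times the leading coefficient 1
  -- from the next coefficient.
  fromRoots-next : ∀ {n} rs → length rs ≡ suc n → coeff (fromRoots rs) n ≈ - sum rs
  fromRoots-next {zero} (r ∷ []) ≡.refl = begin
    0# + - (r * 1#)  ≈⟨ +-identityˡ _ ⟩
    - (r * 1#)       ≈⟨ -‿cong (trans (*-identityʳ r) (sym (+-identityʳ r))) ⟩
    - (r + 0#)       ∎
  fromRoots-next {suc n} (r ∷ rs) |rs|≡ = begin
    coeff (fromRoots (r ∷ rs)) (suc n)                            ≈⟨ coeff-fromRoots-suc r rs n ⟩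
    coeff (fromRoots rs) n - r * coeff (fromRoots rs) (suc n)
      ≈⟨ +-cong (fromRoots-next rs (ℕ.suc-injective |rs|≡)) (-‿cong (*-congˡ leading)) ⟩
    - sum rs - r * 1#                                             ≈⟨ +-congˡ (-‿cong (*-identityʳ r)) ⟩
    - sum rs - r                                                  ≈⟨ -‿anti-homo-+ r (sum rs) ⟨
    - (r + sum rs)                                                ∎
    where
    leading : coeff (fromRoots rs) (suc n) ≈ 1#
    leading = fromRoots-leading′ rs (ℕ.suc-injective |rs|≡)

  eval-fromRoots : ∀ r rs x → eval (fromRoots (r ∷ rs)) x ≈ (x - r) * eval (fromRoots rs) x
  eval-fromRoots r rs x = begin
    eval (fromRoots (r ∷ rs)) x      ≈⟨ eval--ₚ (0# ∷ fromRoots rs) (r ·ₚ fromRoots rs) x ⟩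
    0# + x * p - eval (r ·ₚ fromRoots rs) x  ≈⟨ +-cong (+-identityˡ _) (-‿cong (eval-·ₚ r (fromRoots rs) x)) ⟩
    x * p - r * p                    ≈⟨ [y-z]x≈yx-zx p x r ⟨
    (x - r) * p                      ∎
    where p = eval (fromRoots rs) x

  fromRoots-root : ∀ {x rs} → x ∈ rs → eval (fromRoots rs) x ≈ 0#
  fromRoots-root {x} {r ∷ rs} (here x≈r) = trans (eval-fromRoots r rs x)
    (trans (*-congʳ (x≈y⇒x∙y⁻¹≈ε x≈r)) (zeroˡ _))
  fromRoots-root {x} {r ∷ rs} (there x∈rs) = trans (eval-fromRoots r rs x)
    (trans (*-congˡ (fromRoots-root x∈rs)) (zeroʳ _))

  -- Here `k` is one less than the dimension, so the degree is `2 + k`. The exponent `suc k ℕ.+ 1`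
  -- keeps the form it has in the theorem, so that the two polynomials agree definitionally.
  word : ℕ → Carrier → Poly → Poly
  word k b v = X^ (suc k ℕ.+ 1) -ₚ b ·ₚ X^ (suc k) +ₚ v

  -- Agreement of the word's polynomial with polynomials of degree at most `k`.

  module _ (k : ℕ) (b : Carrier) (v : Poly) (v< : DegreeBelow (suc k) v) where

    private
      p = word k b v

      coeff-p : ∀ i → coeff p i ≈ coeff (X^ (suc k ℕ.+ 1)) i - b * coeff (X^ (suc k)) i + coeff v i
      coeff-p i = trans (coeff-+ₚ (X^ (suc k ℕ.+ 1) -ₚ b ·ₚ X^ (suc k)) v i)
        (+-congʳ (trans (coeff--ₚ (X^ (suc k ℕ.+ 1)) (b ·ₚ X^ (suc k)) i)
          (+-congˡ (-‿cong (coeff-·ₚ b (X^ (suc k)) i)))))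

    word-leading : coeff p (2 ℕ.+ k) ≈ 1#
    word-leading = begin
      coeff p (2 ℕ.+ k)  ≈⟨ coeff-p (2 ℕ.+ k) ⟩
      _                     ≈⟨ +-cong (x-r0≈x _ b (coeff-X^-≢ (suc k) (2 ℕ.+ k) ℕ.1+n≢n)) (v< (2 ℕ.+ k) (ℕ.n≤1+n _)) ⟩
      coeff (X^ (suc k ℕ.+ 1)) (2 ℕ.+ k) + 0#  ≈⟨ +-identityʳ _ ⟩
      coeff (X^ (suc k ℕ.+ 1)) (2 ℕ.+ k)       ≡⟨ ≡.cong (λ m → coeff (X^ m) (2 ℕ.+ k)) (ℕ.+-comm (suc k) 1) ⟩
      coeff (X^ (2 ℕ.+ k)) (2 ℕ.+ k)           ≈⟨ coeff-X^-≡ (2 ℕ.+ k) ⟩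
      1#                    ∎

    word-next : coeff p (suc k) ≈ - b
    word-next = begin
      coeff p (suc k)    ≈⟨ coeff-p (suc k) ⟩
      _                     ≈⟨ +-cong (+-cong (coeff-X^-≢ (suc k ℕ.+ 1) (suc k) (ℕ.m+1+n≢m (suc k) ∘ ≡.sym)) (-‿cong (*-congˡ (coeff-X^-≡ (suc k))))) (v< (suc k) ℕ.≤-refl) ⟩
      0# - b * 1# + 0#      ≈⟨ trans (+-identityʳ _) (+-identityˡ _) ⟩
      - (b * 1#)            ≈⟨ -‿cong (*-identityʳ b) ⟩
      - b                   ∎

    word-degree : DegreeBelow (3 ℕ.+ k) p
    word-degree i 3+k≤i = begin
      coeff p i          ≈⟨ coeff-p i ⟩
      _                     ≈⟨ +-cong (x-r0≈x _ b (coeff-X^-≢ (suc k) i (≢ (ℕ.<⇒≤ 3+k≤i)))) (v< i (ℕ.≤-trans (ℕ.m≤n+m _ 2) 3+k≤i)) ⟩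
      coeff (X^ (suc k ℕ.+ 1)) i + 0#  ≈⟨ +-identityʳ _ ⟩
      coeff (X^ (suc k ℕ.+ 1)) i       ≈⟨ coeff-X^-≢ (suc k ℕ.+ 1) i (≢ (≡.subst (_< i) (ℕ.+-comm 1 (suc k)) 3+k≤i)) ⟩
      0#                    ∎
      where
      ≢ : ∀ {m} → m < i → ¬ (i ≡ m)
      ≢ m<i i≡m = ℕ.<⇒≢ m<i (≡.sym i≡m)

    -- Both polynomials are monic of degree `2 + k`, and the condition on the sum makes their next
    -- coefficients equal, so two coefficients cancel.
    word-fromRoots-degree : ∀ rs → length rs ≡ 2 ℕ.+ k → sum rs ≈ b → DegreeBelow (suc k) (p -ₚ fromRoots rs)
    word-fromRoots-degree rs |rs|≡ Σ≈b i k<i = trans (coeff--ₚ p (fromRoots rs) i) (x≈y⇒x∙y⁻¹≈ε (same (ℕ.m≤n⇒m<n∨m≡n k<i)))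
      where
      same : suc k < i ⊎ suc k ≡ i → coeff p i ≈ coeff (fromRoots rs) i
      same (inj₂ ≡.refl) = trans word-next (trans (-‿cong (sym Σ≈b)) (sym (fromRoots-next rs |rs|≡)))
      same (inj₁ 1+k<i) with ℕ.m≤n⇒m<n∨m≡n 1+k<i
      ... | inj₁ 2+k<i = trans (word-degree i 2+k<i) (sym (fromRoots-degree rs i (≡.subst (_< i) (≡.sym |rs|≡) 2+k<i)))
      ... | inj₂ ≡.refl = trans word-leading (sym (fromRoots-leading′ rs |rs|≡))

    -- The difference `p -ₚ f` is monic of degree `2 + k`; with more roots than that it would be
    -- zero, against its leading coefficient.
    agreement-size : ∀ {rs} f → DegreeBelow (suc k) f → Unique rs → All (λ r → eval p r ≈ eval f r) rs →
      length rs ≤ 2 ℕ.+ k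
    agreement-size {rs} f f< rs! agree with length rs ℕ.≤? 2 ℕ.+ k
    ... | yes |rs|≤ = |rs|≤
    ... | no |rs|≰ = contradiction (trans (sym (g≈0 (2 ℕ.+ k) z≤n)) g-leading) 0≉1
      where
      g = p -ₚ f
      g≈0 : DegreeBelow 0 g
      g≈0 = roots⇒zero g rs! (All.map (λ {r} e → trans (eval--ₚ p f r) (x≈y⇒x∙y⁻¹≈ε e)) agree) (ℕ.≰⇒> |rs|≰)
        λ i 3+k≤i → trans (coeff--ₚ p f i) (x≈y⇒x∙y⁻¹≈ε (trans (word-degree i 3+k≤i) (sym (f< i (ℕ.≤-trans (ℕ.m≤n+m _ 2) 3+k≤i)))))
      g-leading : coeff g (2 ℕ.+ k) ≈ 1#
      g-leading = begin
        coeff g (2 ℕ.+ k)                           ≈⟨ coeff--ₚ p f (2 ℕ.+ k) ⟩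
        coeff p (2 ℕ.+ k) - coeff f (2 ℕ.+ k)    ≈⟨ +-cong word-leading (-‿cong (f< _ (ℕ.n≤1+n _))) ⟩
        1# - 0#                                     ≈⟨ +-congˡ -0#≈0# ⟩
        1# + 0#                                     ≈⟨ +-identityʳ 1# ⟩
        1#                                          ∎

    -- With as many roots as its degree, the monic `p -ₚ f` equals `fromRoots rs`; comparing the
    -- coefficients after the leading ones gives the sum.
    agreement-sum : ∀ {rs} f → DegreeBelow (suc k) f → Unique rs → All (λ r → eval p r ≈ eval f r) rs →
      length rs ≡ 2 ℕ.+ k → sum rs ≈ b
    agreement-sum {rs} f f< rs! agree |rs|≡ = -‿injective $ begin
      - sum rs                     ≈⟨ fromRoots-next rs |rs|≡ ⟨
      coeff (fromRoots rs) (suc k) ≈⟨ x∙y⁻¹≈ε⇒x≈y _ _ (trans (sym (coeff--ₚ (fromRoots rs) g (suc k))) (h≈0 (suc k) z≤n)) ⟩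
      coeff g (suc k)              ≈⟨ coeff--ₚ p f (suc k) ⟩
      coeff p (suc k) - coeff f (suc k) ≈⟨ +-cong word-next (-‿cong (f< _ ℕ.≤-refl)) ⟩
      - b - 0#                     ≈⟨ trans (+-congˡ -0#≈0#) (+-identityʳ _) ⟩
      - b                          ∎
      where
      g = p -ₚ f
      h = fromRoots rs -ₚ g
      -- The leading coefficients cancel in `h`, so its `2 + k` roots are enough to make it zero.
      h-degree : DegreeBelow (2 ℕ.+ k) h
      h-degree i 2+k≤i = trans (coeff--ₚ (fromRoots rs) g i) (x≈y⇒x∙y⁻¹≈ε (trans (same (ℕ.m≤n⇒m<n∨m≡n 2+k≤i)) (sym g≈p)))
        where
        g≈p : coeff g i ≈ coeff p i
        g≈p = trans (coeff--ₚ p f i) (trans (+-congˡ (trans (-‿cong (f< i (ℕ.<⇒≤ 2+k≤i))) -0#≈0#)) (+-identityʳ _))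
        same : 2 ℕ.+ k < i ⊎ 2 ℕ.+ k ≡ i → coeff (fromRoots rs) i ≈ coeff p i
        same (inj₁ 2+k<i) = trans (fromRoots-degree rs i (≡.subst (_< i) (≡.sym |rs|≡) 2+k<i)) (sym (word-degree i 2+k<i))
        same (inj₂ ≡.refl) = trans (fromRoots-leading′ rs |rs|≡) (sym word-leading)
      h≈0 : DegreeBelow 0 h
      h≈0 = roots⇒zero h rs! (All.tabulateₛ S roots) (ℕ.≤-reflexive (≡.sym |rs|≡)) h-degree
        where
        resp : ∀ {x y} → x ≈ y → eval p x ≈ eval f x → eval p y ≈ eval f y
        resp x≈y e = trans (eval-cong p (sym x≈y)) (trans e (eval-cong f x≈y))
        roots : ∀ {r} → r ∈ rs → eval h r ≈ 0#
        roots {r} r∈rs = trans (eval--ₚ (fromRoots rs) g r) (x≈y⇒x∙y⁻¹≈ε (trans (fromRoots-root r∈rs) (sym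
          (trans (eval--ₚ p f r) (x≈y⇒x∙y⁻¹≈ε (All.lookupₛ S resp agree r∈rs))))))

-- Error distances and subset sums

module ErrorDistances {c ℓ : Level} {q : ℕ} (F : FiniteField c ℓ q) where
  open FiniteField F hiding (zero)
  open RingProperties ring
  open FieldLists F
  open Membership S using (_∈_; _∉_)
  open Uniqueness S using (Unique)
  open Polynomials F
  open Codes F
  open Interpolation F

  module _ {n} (D : EvaluationSet n) where

    IsPoint : Pred Carrier ℓ
    IsPoint x = ∃ λ i → point D i ≈ x

    points : ∀ m → m ≤ n → SubsetSum IsPoint m (sum (take m (tabulate (point D))))
    points m m≤n = record
      { subset = take m (tabulate (point D))
      ; unique = Uniqueₚ.take⁺ S m (Uniqueₚ.tabulate⁺ S (distinct D))
      ; within = λ x∈ → let i , x≈ = Membershipₚ.∈-tabulate⁻ S (∈-take m x∈) in i , sym x≈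
      ; size   = ≡.trans (length-take m _) (≡.trans (≡.cong (m ℕ.⊓_) (length-tabulate (point D))) (ℕ.m≤n⇒m⊓n≡m m≤n))
      ; total  = refl
      }
      where
      ∈-take : ∀ m {x xs} → x ∈ take m xs → x ∈ xs
      ∈-take (suc m) {xs = y ∷ xs} (here e)  = here e
      ∈-take (suc m) {xs = y ∷ xs} (there e) = there (∈-take m e)

    module _ (u w : Word n) where

      -- Field elements rather than indices, because they serve as roots and as summands.
      agreement : List Carrier
      agreement = map (point D) (filter (λ i → u i ≟ w i) (allFin n))

      hamming+agreement : hamming u w ℕ.+ length agreement ≡ n
      hamming+agreement = ≡.trans
        (≡.cong (hamming u w ℕ.+_) (length-map (point D) (filter (λ i → u i ≟ w i) (allFin n))))
        (count-¬+length-filter (λ i → u i ≟ w i) id)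

      agreement! : Unique agreement
      agreement! = Uniqueₚ.map⁺ (≡.setoid (Fin n)) S (distinct D)
        (Uniqueₚ.filter⁺ (≡.setoid (Fin n)) (λ i → u i ≟ w i) {xs = allFin n} (Uniqueₚ.tabulate⁺ (≡.setoid (Fin n)) id))

      agreement⁻ : ∀ {x} → x ∈ agreement → ∃ λ i → x ≈ point D i × u i ≈ w i
      agreement⁻ x∈ =
        let i , _ , x≈ , ui≈wi = Membershipₚ.∈-map∘filter⁻ (≡.setoid (Fin n)) S
                                   (λ i → u i ≟ w i) (λ { ≡.refl e → e }) {xs = allFin n} x∈
        in i , x≈ , ui≈wi

      agreement⁺ : ∀ {x} i → x ≈ point D i → u i ≈ w i → x ∈ agreement
      agreement⁺ i x≈ ui≈wi = Membershipₚ.∈-map∘filter⁺ (≡.setoid (Fin n)) S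
        (λ i → u i ≟ w i) (λ { ≡.refl e → e }) (λ { ≡.refl → refl })
        (i , Membershipₚ.∈-tabulate⁺ (≡.setoid (Fin n)) i , x≈ , ui≈wi)

      hamming≡ : n ∸ length agreement ≡ hamming u w
      hamming≡ = ≡.trans (≡.cong (_∸ length agreement) (≡.sym hamming+agreement))
        (ℕ.m+n∸n≡m (hamming u w) (length agreement))

      hamming-≥ : ∀ {m} → length agreement ≤ m → n ∸ m ≤ hamming u w
      hamming-≥ {m} A≤m = ≡.subst (n ∸ m ≤_) hamming≡ (ℕ.∸-monoʳ-≤ n A≤m)

      hamming-≤ : ∀ {m} → m ≤ length agreement → hamming u w ≤ n ∸ m
      hamming-≤ {m} m≤A = ≡.subst (_≤ n ∸ m) hamming≡ (ℕ.∸-monoʳ-≤ n m≤A)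

    module _ (k : ℕ) (b : Carrier) (v : Poly) (v< : DegreeBelow (suc k) v)
             (u : Word n) (u≈ : ∀ i → eval (word k b v) (point D i) ≈ u i) where

      private
        p = word k b v

      -- The codeword p - ∏ (X - r) agrees with p at every r.
      near-codeword : ∀ {m s} (T : SubsetSum IsPoint m s) rs → length rs ≡ 2 ℕ.+ k → sum rs ≈ b →
        SubsetSum.subset T ⊆ rs → ∃ λ w → ReedSolomon D (suc k) w × hamming u w ≤ n ∸ m
      near-codeword {m} T rs |rs|≡ Σ≈b T⊆rs = w ,
        (f , word-fromRoots-degree k b v v< rs |rs|≡ Σ≈b , λ _ → refl) ,
        hamming-≤ u w (≡.subst (_≤ length (agreement u w)) size (length-mono-⊆ unique T⊆agreement))
        where
        open SubsetSum T
        f = p -ₚ fromRoots rs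
        w : Word n
        w i = eval f (point D i)
        T⊆agreement : subset ⊆ agreement u w
        T⊆agreement {x} x∈T = agreement⁺ u w i (sym i≈x) (trans (sym (u≈ i)) (sym wi≈))
          where
          i = proj₁ (within x∈T)
          i≈x = proj₂ (within x∈T)
          root : eval (fromRoots rs) (point D i) ≈ 0#
          root = fromRoots-root (Membershipₚ.∈-resp-≈ S (sym i≈x) (T⊆rs x∈T))
          wi≈ : w i ≈ eval p (point D i)
          wi≈ = trans (eval--ₚ p (fromRoots rs) (point D i))
            (trans (+-congˡ (trans (-‿cong root) -0#≈0#)) (+-identityʳ _))

      module _ (w : Word n) (w∈C : ReedSolomon D (suc k) w) where
        private
          f  = proj₁ w∈C
          f< = proj₁ (proj₂ w∈C)
          w≈ = proj₂ (proj₂ w∈C)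

          agree : All (λ r → eval p r ≈ eval f r) (agreement u w)
          agree = All.tabulateₛ S λ x∈ → let i , x≈ , ui≈wi = agreement⁻ u w x∈ in
            trans (eval-cong p x≈) (trans (u≈ i) (trans ui≈wi (trans (w≈ i) (eval-cong f (sym x≈)))))

        length-agreement≤ : length (agreement u w) ≤ 2 ℕ.+ k
        length-agreement≤ = agreement-size k b v v< f f< (agreement! u w) agree

        length-agreement≡ : length (agreement u w) ≡ 2 ℕ.+ k → SubsetSum IsPoint (2 ℕ.+ k) b
        length-agreement≡ |A|≡ = record
          { subset = agreement u w
          ; unique = agreement! u w
          ; within = λ x∈ → let i , x≈ , _ = agreement⁻ u w x∈ in i , sym x≈
          ; size   = |A|≡
          ; total  = agreement-sum k b v v< f f< (agreement! u w) agree |A|≡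
          }

      distance : ∀ {d} → (∃ λ w → ReedSolomon D (suc k) w × hamming u w ≤ d) →
        (∀ w → ReedSolomon D (suc k) w → d ≤ hamming u w) → ErrorDistance u (ReedSolomon D (suc k)) d
      distance (w , w∈C , ≤d) d≤ = (w , w∈C , ℕ.≤-antisym ≤d (d≤ w w∈C)) , d≤

      -- Taking the subset as the roots gives `2 + k` agreements, and no codeword has more.
      distance-SubsetSum : SubsetSum IsPoint (2 ℕ.+ k) b → ErrorDistance u (ReedSolomon D (suc k)) (n ∸ (2 ℕ.+ k))
      distance-SubsetSum T = distance (near-codeword T subset size total id)
        (λ w w∈C → hamming-≥ u w (length-agreement≤ w w∈C))
        where open SubsetSum T

      distance-¬SubsetSum : suc k ≤ n → ¬ SubsetSum IsPoint (2 ℕ.+ k) b →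
        ErrorDistance u (ReedSolomon D (suc k)) (n ∸ suc k)
      distance-¬SubsetSum k<n ¬T = distance
        -- The extra root is chosen to bring the sum to `b`. It may repeat a root or lie outside
        -- `D`, since only the agreement at the `suc k` given points is counted.
        (near-codeword P ((b - sum subset) ∷ subset) (≡.cong suc size) (//-rightDividesˡ (sum subset) b) there)
        -- Exactly `2 + k` agreements would form a subset with sum `b`, so at most `suc k` remain
        -- possible.
        (λ w w∈C → hamming-≥ u w (ℕ.≤-pred (ℕ.≤∧≢⇒< (length-agreement≤ w w∈C) (¬T ∘ length-agreement≡ w w∈C))))
        where
        P = points (suc k) k<n
        open SubsetSum P

-- The successor rules out that truncated subtraction has cut `n ∸ o` off at 0.
suc≤∸⇒+suc≤ : ∀ {m n} o → suc m ≤ n ∸ o → o ℕ.+ suc m ≤ n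
suc≤∸⇒+suc≤ zero              m<n   = m<n
suc≤∸⇒+suc≤ {n = suc n} (suc o) m<n∸o = s≤s (suc≤∸⇒+suc≤ o m<n∸o)

suc≡∸⇒+suc≡ : ∀ {m n} o → suc m ≡ n ∸ o → o ℕ.+ suc m ≡ n
suc≡∸⇒+suc≡ zero              m≡n   = m≡n
suc≡∸⇒+suc≡ {n = suc n} (suc o) m≡n∸o = ≡.cong suc (suc≡∸⇒+suc≡ o m≡n∸o)

-- The standard and the primitive code.

module _ {c ℓ : Level} {q : ℕ} (F : FiniteField c ℓ q) where
  open FiniteField F hiding (zero)
  open FieldLists F
  open Membership S using (_∈_; _∉_)
  open Polynomials F
  open Codes F
  open Interpolation F
  open ErrorDistances F

  p≡2⇒1+1≈0 : ∀ {p} → HasCharacteristic F p → p ≡ 2 → 1# + 1# ≈ 0#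
  p≡2⇒1+1≈0 (_ , 2×1≈0 , _) ≡.refl = trans (+-congˡ (sym (+-identityʳ 1#))) 2×1≈0

  1+1≈0⇒p≡2 : ∀ {p} → HasCharacteristic F p → 1# + 1# ≈ 0# → p ≡ 2
  1+1≈0⇒p≡2 {p} (0<p , p×1≈0 , minimal) 1+1≈0
    with p | minimal 2 (s≤s z≤n) (trans (+-congˡ (+-identityʳ 1#)) 1+1≈0)
  ... | 2 | _ = ≡.refl
  ... | 1 | _ = contradiction (trans (sym p×1≈0) (+-identityʳ 1#)) 0≉1
  ... | suc (suc (suc _)) | s≤s (s≤s ())

  distance-Standard : ∀ {p} k → HasCharacteristic F p → (b : Carrier) → 3 ℕ.+ k ≤ q →
    (D : EvaluationSet q) → Standard D →
    (u : Word q) (v : Poly) → DegreeBelow (suc k) v →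
    (∀ i → eval (word k b v) (point D i) ≈ u i) →
    let exceptional = (b ≈ 0# × p ≡ 2 × suc k ≡ 1) ⊎ (b ≈ 0# × p ≡ 2 × suc k ≡ q ∸ 3)
    in (exceptional → ErrorDistance u (ReedSolomon D (suc k)) (q ∸ suc k))
     × (¬ exceptional → ErrorDistance u (ReedSolomon D (suc k)) (q ∸ suc k ∸ 1))
  distance-Standard {p} k char b 3+k≤q D standard u v v< u≈ =
      (λ exceptional → distance-¬SubsetSum D k b v v< u u≈ (ℕ.≤-trans (ℕ.m≤n+m _ 2) 3+k≤q) (no-subset exceptional))
    , (λ ¬exceptional → ≡.subst (ErrorDistance u (ReedSolomon D (suc k))) ∸≡
        (distance-SubsetSum D k b v v< u u≈ (a-subset ¬exceptional)))
    where
    exceptional = (b ≈ 0# × p ≡ 2 × suc k ≡ 1) ⊎ (b ≈ 0# × p ≡ 2 × suc k ≡ q ∸ 3)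

    ∸≡ : q ∸ (2 ℕ.+ k) ≡ q ∸ suc k ∸ 1
    ∸≡ = ≡.sym (≡.trans (ℕ.∸-+-assoc q (suc k) 1) (≡.cong (q ∸_) (ℕ.+-comm (suc k) 1)))

    no-subset : exceptional → ¬ SubsetSum (IsPoint D) (2 ℕ.+ k) b
    no-subset (inj₁ (b≈0 , p≡2 , ≡.refl)) T = ¬SubsetSum-2 (p≡2⇒1+1≈0 char p≡2) (convert id ≡.refl b≈0 T)
    -- The subset has `2 + k` = q - 2 elements, so exactly two field elements are missing.
    no-subset (inj₂ (b≈0 , p≡2 , k≡q-3)) T = cosize-2 (p≡2⇒1+1≈0 char p≡2) (ℕ.≤-trans (ℕ.m≤m+n 3 k) 3+k≤q)
      unique (≡.trans (≡.cong (2 ℕ.+_) size) (suc≡∸⇒+suc≡ 3 k≡q-3)) (trans total b≈0)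
      where open SubsetSum T

    a-subset : ¬ exceptional → SubsetSum (IsPoint D) (2 ℕ.+ k) b
    a-subset ¬exceptional with b ≟ 0# | (1# + 1#) ≟ 0#
    ... | no b≉0  | _ = nonzero-SubsetSum (λ _ _ → standard _) (λ _ _ → standard _) unique within size b≉0
      -- One point more than the size of the subset, for the exchange.
      where open SubsetSum (points D (3 ℕ.+ k) 3+k≤q)
    ... | yes b≈0 | no 2≉0 = convert (λ _ → standard _) ≡.refl (sym b≈0) (Odd.zero-SubsetSum 2≉0 (2 ℕ.+ k) 3+k≤q)
    ... | yes b≈0 | yes 2≈0 = convert (λ _ → standard _) ≡.refl (sym b≈0)
      (Even.zero-SubsetSum 2≈0 (2 ℕ.+ k) (s≤s z≤n) 3+k≤q
        (λ { ≡.refl → ¬exceptional (inj₁ (b≈0 , p≡2 , ≡.refl)) })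
        (λ { ≡.refl → ¬exceptional (inj₂ (b≈0 , p≡2 , ≡.refl)) }))
      where p≡2 = 1+1≈0⇒p≡2 char 2≈0

  distance-Primitive : ∀ {p} k → HasCharacteristic F p → (b : Carrier) → 5 < q → 4 ℕ.+ k ≤ q →
    (D : EvaluationSet (q ∸ 1)) → Primitive D →
    (u : Word (q ∸ 1)) (v : Poly) → DegreeBelow (suc k) v →
    (∀ i → eval (word k b v) (point D i) ≈ u i) →
    let exceptional = (b ≈ 0# × p ≡ 2 × suc k ≡ 1) ⊎ (b ≈ 0# × p ≡ 2 × suc k ≡ q ∸ 4) ⊎ (b ≈ 0# × suc k ≡ q ∸ 3)
    in (exceptional → ErrorDistance u (ReedSolomon D (suc k)) (q ∸ suc k ∸ 1))
     × (¬ exceptional → ErrorDistance u (ReedSolomon D (suc k)) (q ∸ suc k ∸ 2))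
  distance-Primitive {p} k char b 5<q 4+k≤q D (point≉0 , covers) u v v< u≈ =
      (λ exceptional → ≡.subst (ErrorDistance u (ReedSolomon D (suc k))) (∸-swap 1 (suc k) (suc k) 1 (ℕ.+-comm 1 (suc k)))
        (distance-¬SubsetSum D k b v v< u u≈ (ℕ.≤-trans (ℕ.m≤n+m _ 2) 3+k≤q-1) (no-subset exceptional)))
    , (λ ¬exceptional → ≡.subst (ErrorDistance u (ReedSolomon D (suc k))) (∸-swap 1 (2 ℕ.+ k) (suc k) 2 (≡.cong suc (ℕ.+-comm 2 k)))
        (distance-SubsetSum D k b v v< u u≈ (a-subset ¬exceptional)))
    where
    exceptional = (b ≈ 0# × p ≡ 2 × suc k ≡ 1) ⊎ (b ≈ 0# × p ≡ 2 × suc k ≡ q ∸ 4) ⊎ (b ≈ 0# × suc k ≡ q ∸ 3)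

    3+k≤q-1 : 3 ℕ.+ k ≤ q ∸ 1
    3+k≤q-1 = ℕ.∸-monoˡ-≤ 1 4+k≤q

    2<q : 2 < q
    2<q = ℕ.≤-trans (ℕ.m≤n+m 3 3) 5<q

    ∸-swap : ∀ i j i′ j′ → i ℕ.+ j ≡ i′ ℕ.+ j′ → q ∸ i ∸ j ≡ q ∸ i′ ∸ j′
    ∸-swap i j i′ j′ e = ≡.trans (ℕ.∸-+-assoc q i j) (≡.trans (≡.cong (q ∸_) e) (≡.sym (ℕ.∸-+-assoc q i′ j′)))

    IsPoint-nonzero : ∀ {x} → IsPoint D x → ¬ (x ≈ 0#)
    IsPoint-nonzero (i , i≈x) x≈0 = point≉0 i (trans i≈x x≈0)

    no-subset : exceptional → ¬ SubsetSum (IsPoint D) (2 ℕ.+ k) b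
    no-subset (inj₁ (b≈0 , p≡2 , ≡.refl)) T = ¬SubsetSum-2 (p≡2⇒1+1≈0 char p≡2) (convert id ≡.refl b≈0 T)
    no-subset (inj₂ exceptional) T = complement exceptional
      where
      open SubsetSum T
      0∉T : 0# ∉ subset
      0∉T 0∈T = IsPoint-nonzero (within 0∈T) refl
      complement : ¬ ((b ≈ 0# × p ≡ 2 × suc k ≡ q ∸ 4) ⊎ (b ≈ 0# × suc k ≡ q ∸ 3))
      -- Adjoining 0 keeps the sum and gives q - 2 elements here and q - 1 in the next clause, where
      -- the single missing element would have to be 0.
      complement (inj₁ (b≈0 , p≡2 , k≡q-4)) = cosize-2 (p≡2⇒1+1≈0 char p≡2) 2<q (0∉T ∷! unique)
        (≡.trans (≡.cong (3 ℕ.+_) size) (suc≡∸⇒+suc≡ 4 k≡q-4)) (trans (+-identityˡ _) (trans total b≈0))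
      complement (inj₂ (b≈0 , k≡q-3)) = cosize-1 2<q (0∉T ∷! unique)
        (≡.trans (≡.cong (2 ℕ.+_) size) (suc≡∸⇒+suc≡ 3 k≡q-3)) (trans (+-identityˡ _) (trans total b≈0)) (here refl)

    a-subset : ¬ exceptional → SubsetSum (IsPoint D) (2 ℕ.+ k) b
    a-subset ¬exceptional with b ≟ 0#
    ... | no b≉0 = nonzero-SubsetSum
      (λ {a} {x} a≉0 x∈D → covers (a * x) (λ ax≈0 → IsPoint-nonzero x∈D (x*y≈0⇒y≈0 a≉0 ax≈0)))
      (λ { x≈y (i , i≈x) → i , trans i≈x x≈y })
      unique within size b≉0
      where open SubsetSum (points D (3 ℕ.+ k) 3+k≤q-1)
    ... | yes b≈0 = convert (λ {x} → covers x) ≡.refl (sym b≈0) zero-sum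
      where
      5+k≤q : 5 ℕ.+ k ≤ q
      -- Equality in `4 + k ≤ q` is the exceptional case `suc k ≡ q ∸ 3`. In characteristic two,
      -- equality in `5 + k ≤ q` is likewise the case `suc k ≡ q ∸ 4`.
      5+k≤q = ℕ.≤∧≢⇒< 4+k≤q λ { ≡.refl → ¬exceptional (inj₂ (inj₂ (b≈0 , ≡.refl))) }
      zero-sum : SubsetSum NonZero# (2 ℕ.+ k) 0#
      zero-sum with (1# + 1#) ≟ 0#
      ... | no 2≉0  = Odd.zero-SubsetSum* 2≉0 5<q (2 ℕ.+ k) (s≤s (s≤s z≤n)) 5+k≤q
      ... | yes 2≈0 = Even.zero-SubsetSum* 2≈0 (2 ℕ.+ k) (s≤s (s≤s z≤n))
        (ℕ.≤∧≢⇒< 5+k≤q λ { ≡.refl → ¬exceptional (inj₂ (inj₁ (b≈0 , p≡2 , ≡.refl))) })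
        (λ { ≡.refl → ¬exceptional (inj₁ (b≈0 , p≡2 , ≡.refl)) })
        where p≡2 = 1+1≈0⇒p≡2 char 2≈0

open import Data.Nat using (_+_)

theorem1 : ∀ {c ℓ} (q p k : ℕ) (F : FiniteField c ℓ q) →
  let open FiniteField F using (Carrier)
      open FiniteField F using (_≈_)
      open FiniteField F using (0#)
      open Polynomials F
      open Codes F
  in HasCharacteristic F p → 1 ≤ k → (b : Carrier) →
     (k + 1 ≤ q ∸ 1 →
       (D : EvaluationSet q) → Standard D →
       (u : Word q) (v : Poly) → DegreeAtMost (k ∸ 1) v →
       IsRepresentedBy D u (X^ (k + 1) -ₚ b ·ₚ X^ k +ₚ v) →
       let exceptional = (b ≈ 0# × p ≡ 2 × k ≡ 1)
                       ⊎ (b ≈ 0# × p ≡ 2 × k ≡ q ∸ 3)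
       in (exceptional → ErrorDistance u (ReedSolomon D k) (q ∸ k))
        × (¬ exceptional → ErrorDistance u (ReedSolomon D k) (q ∸ k ∸ 1)))
     ×
     (5 < q → k + 1 ≤ q ∸ 2 →
       (D : EvaluationSet (q ∸ 1)) → Primitive D →
       (u : Word (q ∸ 1)) (v : Poly) → DegreeAtMost (k ∸ 1) v →
       IsRepresentedBy D u (X^ (k + 1) -ₚ b ·ₚ X^ k +ₚ v) →
       let exceptional = (b ≈ 0# × p ≡ 2 × k ≡ 1)
                       ⊎ (b ≈ 0# × p ≡ 2 × k ≡ q ∸ 4)
                       ⊎ (b ≈ 0# × k ≡ q ∸ 3)
       in (exceptional → ErrorDistance u (ReedSolomon D k) (q ∸ k ∸ 1))
        × (¬ exceptional → ErrorDistance u (ReedSolomon D k) (q ∸ k ∸ 2)))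
theorem1 q p (suc k) F char _ b =
    (λ k+1≤q-1 D standard u v v< (_ , u≈) → distance-Standard F k char b
      (≡.subst (_≤ q) (≡.cong (2 ℕ.+_) (ℕ.+-comm k 1)) (suc≤∸⇒+suc≤ 1 k+1≤q-1)) D standard u v v< u≈)
  , (λ 5<q k+1≤q-2 D Dᵖ u v v< (_ , u≈) → distance-Primitive F k char b 5<q
      (≡.subst (_≤ q) (≡.cong (3 ℕ.+_) (ℕ.+-comm k 1)) (suc≤∸⇒+suc≤ 2 k+1≤q-2)) D Dᵖ u v v< u≈)
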